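{- For every pair of positive integers $\ell,r$ with $r\geq 3$, there exists a positive integer $N=N(\ell,r)$ such that for every integer $n\geq N$, $$rx_{3,\ell}(K_{r\times n})=\begin{cases}3 & \text{if } r=3 \text{ and } \ell\in\{1,2,3\},\\ 4 & \text{if } r=3 \text{ and } \ell\geq 4,\\ 3 & \text{if } r\geq 4.\end{cases}$$
   Context: All graphs are undirected, finite and simple. $K_{r\times n}$ is the complete multipartite graph with $r$ vertex classes, each of size $n$. An edge-coloring of a graph $G$ with $t$ colors is any map $c:E(G)\to\{1,\dots,t\}$ (adjacent edges may receive the same color). A tree $T$ that is a subgraph of $G$ is a rainbow tree if no two edges of $T$ have the same color. For $S\subseteq V(G)$, an $S$-tree is a tree in $G$ containing all vertices of $S$, and a rainbow $S$-tree is an $S$-tree that is a rainbow tree. Rainbow $S$-trees $T_1,\dots,T_\ell$ are internally disjoint if $E(T_i)\cap E(T_j)=\emptyset$ and $V(T_i)\cap V(T_j)=S$ for all $1\le i,j\le \ell$ with $i\neq j$. The $(k,\ell)$-rainbow index $rx_{k,\ell}(G)$ is the minimum number of colors needed in an edge-coloring of $G$ such that for every set $S$ of $k$ vertices of $G$ there exist $\ell$ internally disjoint rainbow $S$-trees. -}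

module Defs where

open import Data.Empty using (⊥)
open import Data.Fin using (Fin; quotient)
open import Data.Fin.Properties using (_≟_)
open import Data.Fin.Subset using (Subset; _∈_; _⊆_; _∩_; ∣_∣; Nonempty)
open import Data.List using (List; []; _∷_; _∷ʳ_; length)
open import Data.List.Relation.Unary.Linked using (Linked)
open import Data.List.Relation.Unary.Unique.Propositional using (Unique)
open import Data.Nat using (ℕ; _*_; _≤_)
open import Data.Product using (Σ; Σ-syntax; _×_)
open import Data.Sum using (_⊎_)
open import Function using (_∘_)
open import Level using (0ℓ)
open import Relation.Binary using (Rel; Decidable; Symmetric; Irreflexive)
open import Relation.Binary.Construct.Closure.ReflexiveTransitive using (Star)
open import Relation.Binary.PropositionalEquality using (_≡_; _≢_; refl; sym)
open import Relation.Nullary using (¬_)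
open import Relation.Nullary.Decidable using (¬?)

record Graph : Set₁ where
  field
    order  : ℕ
  Vertex : Set
  Vertex = Fin order
  field
    Adj    : Rel Vertex 0ℓ
    adj?   : Decidable Adj
    symm   : Symmetric Adj
    irrefl : Irreflexive _≡_ Adj

-- The vertex x of Fin (r * n) lies in class `quotient n x`; each class is a
-- block of n consecutive vertices.
completeMultipartite : (r n : ℕ) → Graph
completeMultipartite r n = record
  { order  = r * n
  ; Adj    = λ x y → quotient {r} n x ≢ quotient {r} n y
  ; adj?   = λ x y → ¬? (quotient {r} n x ≟ quotient {r} n y)
  ; symm   = λ x≢y → x≢y ∘ sym
  ; irrefl = λ { refl x≢x → x≢x refl }
  }

module _ (G : Graph) where
  open Graph G

  -- A map on unordered edges: `colour-sym` identifies the two orientations of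
  -- an edge and also makes the colour independent of the adjacency proof.
  record EdgeColouring (t : ℕ) : Set where
    field
      colour     : (u v : Vertex) → Adj u v → Fin t
      colour-sym : ∀ {u v} (p : Adj u v) (q : Adj v u) → colour u v p ≡ colour v u q

  record Subgraph : Set₁ where
    field
      vertices : Subset order
      Edge     : Rel Vertex 0ℓ
      edge?    : Decidable Edge
      edge-sym : Symmetric Edge
      edge-adj : ∀ {u v} → Edge u v → Adj u v
      edge-∈   : ∀ {u v} → Edge u v → u ∈ vertices × v ∈ vertices

module _ {G : Graph} where
  open Graph G
  open Subgraph
  open EdgeColouring

  Connected : Subgraph G → Set
  Connected H = ∀ {u v} → u ∈ vertices H → v ∈ vertices H → Star (Edge H) u v

  -- The list x₁, …, xₘ stands for the cycle x₁ x₂ … xₘ x₁.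
  IsCycle : Subgraph G → List Vertex → Set
  IsCycle H []       = ⊥
  IsCycle H (x ∷ xs) =
    3 ≤ length (x ∷ xs) × Unique (x ∷ xs) × Linked (Edge H) ((x ∷ xs) ∷ʳ x)

  Acyclic : Subgraph G → Set
  Acyclic H = ∀ xs → ¬ IsCycle H xs

  IsTree : Subgraph G → Set
  IsTree H = Nonempty (vertices H) × Connected H × Acyclic H

  IsRainbow : ∀ {t} → EdgeColouring G t → Subgraph G → Set
  IsRainbow c H = ∀ {u v x y} (e : Edge H u v) (f : Edge H x y) →
    colour c u v (edge-adj H e) ≡ colour c x y (edge-adj H f) →
    (u ≡ x × v ≡ y) ⊎ (u ≡ y × v ≡ x)

  IsRainbowSTree : ∀ {t} → EdgeColouring G t → Subset order → Subgraph G → Set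
  IsRainbowSTree c S T = IsTree T × S ⊆ vertices T × IsRainbow c T

  InternallyDisjoint : ∀ {ℓ} → Subset order → (Fin ℓ → Subgraph G) → Set
  InternallyDisjoint S T = ∀ i j → i ≢ j →
    (∀ u v → ¬ (Edge (T i) u v × Edge (T j) u v)) ×
    vertices (T i) ∩ vertices (T j) ≡ S

module _ (k ℓ : ℕ) (G : Graph) where
  open Graph G

  IsRainbowColouring : ∀ {t} → EdgeColouring G t → Set₁
  IsRainbowColouring c = (S : Subset order) → ∣ S ∣ ≡ k →
    Σ[ T ∈ (Fin ℓ → Subgraph G) ]
      (∀ i → IsRainbowSTree c S (T i)) × InternallyDisjoint S T

  RainbowColourable : ℕ → Set₁
  RainbowColourable t = Σ (EdgeColouring G t) IsRainbowColouring

  -- `IsRainbowIndex k ℓ G t` says rx_{k,ℓ}(G) = t.  It is a relation because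
  -- the minimum need not exist for an arbitrary G.
  IsRainbowIndex : ℕ → Set₁
  IsRainbowIndex t = RainbowColourable t × (∀ s → RainbowColourable s → t ≤ s)

{-# OPTIONS --safe #-}

-- Upper bounds.  For large n there is a colouring of K_{r×n} in which, for every
-- class and every three vertices x, y, z, each triple of colours is realised as
-- (c(vx), c(vy), c(vz)) by many vertices v of that class: v carries a test that
-- inspects at most two digits of a vertex written with three digits in a base of
-- order n^(1/2), so only O(n) tests are needed, and a Paley tournament decides
-- which end of an edge applies its test to the other.  If the triple misses a
-- class, rainbow stars centred there suffice.  A triple xyz meeting all three
-- classes of K_{3×n} is spanned with three colours by the paths x–y–v–z, v in the
-- class of x, and their two rotations, and with four colours by arbitrarily many
-- paths x–v–z–u–y with u in the class of x and v in the class of y.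
--
-- Lower bounds.  A tree on an independent triple has three distinct edges at the
-- triple; if only three colours are available these are all its edges, so the
-- triple has a common neighbour.  In K_{3×n} a transversal triple has none, so
-- every tree uses an edge of the triangle, which leaves room for three trees only.
module Submission where

open import Defs
open import Data.Bool using (Bool; true; false; if_then_else_)
import Data.Bool.Properties as Bool
open import Data.Empty using (⊥)
open import Data.Fin using (Fin; zero; suc; toℕ; combine; remainder; quotient; inject≤; finToFun; funToFin)
import Data.Fin as Fin
open import Data.Fin.Properties using
  ( _≟_; all?; any?; *↔×; toℕ-combine; toℕ<n; toℕ-inject≤; toℕ-injective; toℕ-fromℕ<
  ; suc-injective; inject≤-injective; combine-injective
  ; remQuot-combine; funToFin-finToFin; pigeonhole; injective⇒≤; <⇒≢)
open import Data.Fin.Subset using (Subset; inside; outside; ⁅_⁆; ⋃; ∣_∣; _∪_)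
  renaming (_∈_ to _∈ₛ_; _∉_ to _∉ₛ_)
open import Data.Fin.Subset.Properties using
  (x∈p∪q⁺; x∈p∪q⁻; x∈⁅x⁆; x∈⁅y⁆⇒x≡y; ∉⊥; ⊆-antisym; x∈p∩q⁺; x∈p∩q⁻; ∪-identityˡ; ∣⊥∣≡0)
open import Data.List using (List; []; _∷_; _∷ʳ_; _++_; length; map; lookup; initLast; _∷ʳ′_)
import Data.List.Membership.DecPropositional as DecMembership
open import Data.List.Membership.Propositional using (_∈_; _∉_)
open import Data.List.Membership.Propositional.Properties using (∈-lookup; ∈-map⁺; ∈-map⁻; ∈-++⁺ʳ)
open import Data.List.Properties using (length-map; ++-assoc)
open import Data.List.Relation.Unary.All as All using (All; []; _∷_)
open import Data.List.Relation.Unary.AllPairs as AllPairs using (AllPairs; []; _∷_)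
import Data.List.Relation.Unary.AllPairs.Properties as AllPairs
open import Data.List.Relation.Unary.Any using (here; there; index)
open import Data.List.Relation.Unary.Any.Properties using (lookup-index)
open import Data.List.Relation.Unary.Linked as Linked using (Linked; []; [-]; _∷_)
open import Data.List.Relation.Unary.Linked.Properties using (Linked⇒AllPairs)
open import Data.List.Relation.Unary.Unique.DecPropositional using (unique?)
open import Data.List.Relation.Unary.Unique.Propositional using (Unique)
import Data.List.Relation.Unary.Unique.Propositional.Properties as Unique
open import Data.Nat using
  (ℕ; zero; suc; _+_; _*_; _∸_; _^_; _≤_; _<_; z≤n; s≤s; NonZero; >-nonZero; >-nonZero⁻¹)
open import Data.Nat.DivMod using (_mod_; _%_; m<n⇒m%n≡m; [m+kn]%n≡m%n)
import Data.Nat.Properties as ℕ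
open import Data.Nat.Tactic.RingSolver using (solve-∀)
open import Data.Product using (Σ-syntax; ∃-syntax; _×_; _,_; proj₁; proj₂)
open import Data.Product.Function.NonDependent.Propositional using (_×-↔_)
open import Data.Product.Properties using (≡-dec)
open import Data.Sum using (_⊎_; inj₁; inj₂; [_,_]′; swap)
open import Data.Unit using (⊤)
open import Data.Vec using (Vec; []; _∷_)
import Data.Vec as Vec
open import Function using (_∘_; id; _↔_; Inverse)
open import Function.Construct.Composition using (_↔-∘_)
open import Function.Construct.Identity using (↔-id)
open import Level using (0ℓ)
open import Relation.Binary using (Rel; Transitive; tri<; tri≈; tri>)
open import Relation.Binary.Construct.Closure.ReflexiveTransitive as Star using (Star; ε; _◅_; _◅◅_)
open import Relation.Binary.PropositionalEquality
  using (_≡_; _≢_; refl; sym; trans; cong; cong₂; subst; module ≡-Reasoning)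
open import Relation.Nullary using (¬_; Dec; yes; no; contradiction)
open import Relation.Nullary.Decidable using
  (from-yes; ¬?; _×-dec_; _⊎-dec_; _→-dec_; dec-true; dec-false; does; decidable-stable)

-- The Paley tournament and tests on digits

quadraticResidue : Vec Bool 19
quadraticResidue =
  false ∷ true ∷ false ∷ false ∷ true ∷ true ∷ true ∷ true ∷ false ∷ true ∷ false ∷
  true ∷ false ∷ false ∷ false ∷ false ∷ true ∷ true ∷ false ∷ []

-- The Paley tournament of order 19, the least order of a tournament in which
-- any three vertices have a common beater.
beats : Fin 19 → Fin 19 → Bool
beats p q = Vec.lookup quadraticResidue ((toℕ p + (19 ∸ toℕ q)) mod 19)

Beats : Fin 19 → Fin 19 → Set
Beats p q = beats p q ≡ true

abstract
  -- As 19 is 3 modulo 4, minus one is a non-residue, so p - q and q - p are never both residues.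
  -- The proof evaluates all pairs.
  Beats-asym : ∀ p q → Beats p q → ¬ Beats q p
  Beats-asym = from-yes (all? λ p → all? λ q →
    (beats p q Bool.≟ true) →-dec ¬? (beats q p Bool.≟ true))

  -- Checked over all triples, repetitions included: distinct vertices of the graph may be assigned
  -- the same vertex of the tournament.
  commonBeater : ∀ p q s → ∃[ w ] (Beats w p × Beats w q × Beats w s)
  commonBeater = from-yes (all? λ p → all? λ q → all? λ s → any? λ w →
    (beats w p Bool.≟ true) ×-dec (beats w q Bool.≟ true) ×-dec (beats w s Bool.≟ true))

-- A decision list: two queries, each a digit position with a value, and one colour per outcome. Two
-- queries can tell three words apart, and the number of tests is only quadratic in k although there
-- are k³ words.
Test : ℕ → ℕ → Set
Test k t = (Fin 3 × Fin k) × (Fin 3 × Fin k) × Fin t × Fin t × Fin t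

run : ∀ {k t} → Test k t → (Fin 3 → Fin k) → Fin t
run ((d , a) , (d′ , a′) , α , β , γ) w =
  if does (w d ≟ a) then α else if does (w d′ ≟ a′) then β else γ

module _ {k t : ℕ} (e e′ : Fin 3 × Fin k) (α β γ : Fin t) (w : Fin 3 → Fin k) where
  private
    d d′ : Fin 3
    d = proj₁ e
    d′ = proj₁ e′
    a a′ : Fin k
    a = proj₂ e
    a′ = proj₂ e′

  run-first : w d ≡ a → run (e , e′ , α , β , γ) w ≡ α
  run-first p rewrite dec-true (w d ≟ a) p = refl

  run-second : w d ≢ a → w d′ ≡ a′ → run (e , e′ , α , β , γ) w ≡ β
  run-second p q rewrite dec-false (w d ≟ a) p | dec-true (w d′ ≟ a′) q = refl

  run-third : w d ≢ a → w d′ ≢ a′ → run (e , e′ , α , β , γ) w ≡ γ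
  run-third p q rewrite dec-false (w d ≟ a) p | dec-false (w d′ ≟ a′) q = refl

Differ : ∀ {k} → (Fin 3 → Fin k) → (Fin 3 → Fin k) → Set
Differ w w′ = ∃[ d ] w d ≢ w′ d

-- At a position where x and y differ, z cannot agree with both. One query there isolates x or y
-- from the other two words, and a second query at a position where the remaining two differ tells
-- those apart.
separatingTest : ∀ {k t} (x y z : Fin 3 → Fin k) → Differ x y → Differ x z → Differ y z →
  (α β γ : Fin t) → ∃[ τ ] (run τ x ≡ α × run τ y ≡ β × run τ z ≡ γ)
separatingTest {k} {t} x y z (d , xy) (d₂ , xz) (d₃ , yz) α β γ with z d ≟ x d
... | no zx = ((d , x d) , (d₃ , y d₃) , α , β , γ)
            , run-first e e′ α β γ x refl
            , run-second e e′ α β γ y (xy ∘ sym) refl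
            , run-third e e′ α β γ z zx (yz ∘ sym)
  where
  e e′ : Fin 3 × Fin k
  e = d , x d
  e′ = d₃ , y d₃
... | yes zx = ((d , y d) , (d₂ , x d₂) , β , α , γ)
             , run-second e e′ β α γ x xy refl
             , run-first e e′ β α γ y refl
             , run-third e e′ β α γ z (λ zy → xy (trans (sym zx) zy)) (xz ∘ sym)
  where
  e e′ : Fin 3 × Fin k
  e = d , y d
  e′ = d₂ , x d₂

-- `funToFin` undoes `finToFun` and depends only on the values, so numbers with equal digits are
-- equal; the position is then found by search.
finToFun-differ : ∀ {m n} {i j : Fin (m ^ n)} → i ≢ j → ∃[ d ] finToFun {m} {n} i d ≢ finToFun j d
finToFun-differ {m} {zero} {zero} {zero} i≢j = contradiction refl i≢j
finToFun-differ {m} {suc n} {i} {j} i≢j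
  with any? (λ d → ¬? (finToFun {m} {suc n} i d ≟ finToFun {m} {suc n} j d))
... | yes p = p
... | no p = contradiction (trans (sym (funToFin-finToFin {suc n} {m} i))
      (trans (funToFin-cong (suc n) agree) (funToFin-finToFin {suc n} {m} j))) i≢j
  where
  agree : ∀ d → finToFun {m} {suc n} i d ≡ finToFun {m} {suc n} j d
  agree d = decidable-stable (finToFun {m} {suc n} i d ≟ finToFun {m} {suc n} j d) (λ q → p (d , q))
  funToFin-cong : ∀ n {f g : Fin n → Fin m} → (∀ d → f d ≡ g d) → funToFin f ≡ funToFin g
  funToFin-cong zero h = refl
  funToFin-cong (suc n) h = cong₂ combine (h zero) (funToFin-cong n (h ∘ suc))

-- Types of vertices and the colouring that they define

abstract
  -- Counts pairs of a tournament vertex and a test; it is bracketed like the nested product, so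
  -- that `types↔` can follow it factor by factor.
  types : ℕ → ℕ → ℕ
  types k t = 19 * ((3 * k) * ((3 * k) * (t * (t * t))))

  types↔ : ∀ k t → Fin (types k t) ↔ (Fin 19 × Test k t)
  types↔ k t = *↔× ⟫ (↔-id _ ×-↔ (*↔× {3 * k} ⟫ (*↔× ×-↔
    (*↔× {3 * k} ⟫ (*↔× ×-↔ (*↔× ⟫ (↔-id _ ×-↔ *↔×)))))))
    where
    _⟫_ : ∀ {A B C : Set} → A ↔ B → B ↔ C → A ↔ C
    f ⟫ g = g ↔-∘ f
    infixr 0 _⟫_

  types-nonZero : ∀ k-1 t-1 → NonZero (types (suc k-1) (suc t-1))
  types-nonZero k-1 t-1 = _

  -- This growth rate makes the construction possible: classes of order k² can hold every type ℓ
  -- times, while k³ words name all the vertices once k is large.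
  types-quadratic : ∀ k t → types k t ≡ types 1 t * (k * k)
  types-quadratic k t = regroup 19 3 k (t * (t * t))
    where
    regroup : ∀ a b k s → a * ((b * k) * ((b * k) * s)) ≡ a * ((b * 1) * ((b * 1) * s)) * (k * k)
    regroup = solve-∀

-- The witnesses are i, q + i, 2q + i and so on; the first ℓ of them lie below ℓq.
residueClass : ∀ {n} ℓ q .{{_ : NonZero q}} → ℓ * q ≤ n → (i : Fin q) →
  ∃[ f ] ((∀ {s s′} → f s ≡ f s′ → s ≡ s′) × (∀ (s : Fin ℓ) → toℕ {n} (f s) mod q ≡ i))
residueClass {n} ℓ q ℓq≤n i = f , f-injective , f-mod
  where
  f : Fin ℓ → Fin n
  f s = inject≤ (combine s i) ℓq≤n

  f-injective : ∀ {s s′} → f s ≡ f s′ → s ≡ s′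
  f-injective {s} {s′} p =
    proj₁ (combine-injective s i s′ i (inject≤-injective ℓq≤n ℓq≤n _ _ p))

  f-mod : ∀ s → toℕ (f s) mod q ≡ i
  f-mod s = toℕ-injective (begin
    toℕ (toℕ (f s) mod q)       ≡⟨ toℕ-fromℕ< _ ⟩
    toℕ (f s) % q               ≡⟨ cong (_% q) (trans (toℕ-inject≤ _ ℓq≤n) (toℕ-combine s i)) ⟩
    (q * toℕ s + toℕ i) % q     ≡⟨ cong (_% q) (ℕ.+-comm (q * toℕ s) (toℕ i)) ⟩
    (toℕ i + q * toℕ s) % q     ≡⟨ cong (λ h → (toℕ i + h) % q) (ℕ.*-comm q (toℕ s)) ⟩
    (toℕ i + toℕ s * q) % q     ≡⟨ [m+kn]%n≡m%n (toℕ i) (toℕ s) q ⟩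
    toℕ i % q                   ≡⟨ m<n⇒m%n≡m (toℕ<n i) ⟩
    toℕ i                       ∎)
    where
    open ≡-Reasoning

-- Colours are given to all pairs of vertices, adjacent or not, so x, y, z may lie in class D
-- themselves. That `f s` avoids x, y, z is not recorded; each packing derives it from the classes
-- or the colours.
record RichColouring (ℓ r n t : ℕ) : Set where
  field
    col     : Fin (r * n) → Fin (r * n) → Fin t
    col-sym : ∀ u v → col u v ≡ col v u
    rich    : ∀ D {x y z} → x ≢ y → x ≢ z → y ≢ z → ∀ α β γ →
      Σ[ f ∈ (Fin ℓ → Fin (r * n)) ] ((∀ {s s′} → f s ≡ f s′ → s ≡ s′) × (∀ s →
        quotient {r} n (f s) ≡ D × col x (f s) ≡ α × col y (f s) ≡ β × col z (f s) ≡ γ))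

module _ {ℓ r n k t q : ℕ} .{{_ : NonZero q}}
  (to : Fin q → Fin 19 × Test k (suc t)) (from : Fin 19 × Test k (suc t) → Fin q)
  (to∘from : ∀ y → to (from y) ≡ y) (rn≤k³ : r * n ≤ k ^ 3) (ℓq≤n : ℓ * q ≤ n) where
  private
    V : Set
    V = Fin (r * n)

    word : V → Fin 3 → Fin k
    word u = finToFun (inject≤ u rn≤k³)

    -- Read off from the position within the class modulo q, so that every class realises each type
    -- at least ℓ times.
    type : V → Fin 19 × Test k (suc t)
    type u = to (toℕ (remainder {r} n u) mod q)

    part : V → Fin 19
    part u = proj₁ (type u)

    test : V → Test k (suc t)
    test u = proj₂ (type u)

    -- Both ends carry a test, and the tournament decides symmetrically which one is run. The colour
    -- `zero` is a default for ends with the same part.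
    col : V → V → Fin (suc t)
    col u v = if beats (part v) (part u) then run (test v) (word u)
      else if beats (part u) (part v) then run (test u) (word v) else zero

    col-beaten : ∀ u v → Beats (part v) (part u) → col u v ≡ run (test v) (word u)
    col-beaten u v p rewrite p = refl

    col-sym : ∀ u v → col u v ≡ col v u
    col-sym u v with beats (part v) (part u) in p | beats (part u) (part v) in q
    ... | true  | true  = contradiction q (Beats-asym (part v) (part u) p)
    ... | true  | false = refl
    ... | false | true  = refl
    ... | false | false = refl

    differ : ∀ {x y} → x ≢ y → Differ (word x) (word y)
    differ x≢y = finToFun-differ {k} {3} (x≢y ∘ inject≤-injective rn≤k³ rn≤k³ _ _)

    -- A common beater of the three parts and a test separating the three words form a single type.
    -- Vertices of that type in class D win against x, y and z, so their test determines all three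
    -- colours.
    rich : ∀ D {x y z} → x ≢ y → x ≢ z → y ≢ z → ∀ α β γ →
      ∃[ f ] ((∀ {s s′} → f s ≡ f s′ → s ≡ s′) × (∀ (s : Fin ℓ) →
        quotient {r} n (f s) ≡ D × col x (f s) ≡ α × col y (f s) ≡ β × col z (f s) ≡ γ))
    rich D {x} {y} {z} x≢y x≢z y≢z α β γ
      with separatingTest (word x) (word y) (word z) (differ x≢y) (differ x≢z) (differ y≢z) α β γ
         | commonBeater (part x) (part y) (part z)
    ... | τ , τx , τy , τz | p , px , py , pz
      with residueClass ℓ q ℓq≤n (from (p , τ))
    ... | g , g-injective , g-mod = f , f-injective , f-spec
      where
      f : Fin ℓ → V
      f s = combine D (g s)

      f-injective : ∀ {s s′} → f s ≡ f s′ → s ≡ s′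
      f-injective {s} {s′} e = g-injective (proj₂ (combine-injective D (g s) D (g s′) e))

      f-type : ∀ s → type (f s) ≡ (p , τ)
      f-type s = begin
        to (toℕ (remainder {r} n (f s)) mod q)  ≡⟨ cong (λ (_ , j) → to (toℕ j mod q)) (remQuot-combine D (g s)) ⟩
        to (toℕ (g s) mod q)                    ≡⟨ cong to (g-mod s) ⟩
        to (from (p , τ))                       ≡⟨ to∘from (p , τ) ⟩
        (p , τ)                                 ∎
        where open ≡-Reasoning

      f-col : ∀ s {u α} → Beats p (part u) → run τ (word u) ≡ α → col u (f s) ≡ α
      f-col s {u} pu τu = trans
        (col-beaten u (f s) (trans (cong (λ h → beats (proj₁ h) (part u)) (f-type s)) pu))
        (trans (cong (λ h → run (proj₂ h) (word u)) (f-type s)) τu)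

      f-spec : ∀ s → quotient {r} n (f s) ≡ D × col x (f s) ≡ α × col y (f s) ≡ β × col z (f s) ≡ γ
      f-spec s = cong proj₁ (remQuot-combine D (g s)) , f-col s px τx , f-col s py τy , f-col s pz τz

  richColouring : RichColouring ℓ r n (suc t)
  richColouring = record { col = col ; col-sym = col-sym ; rich = rich }

-- Integer square roots and the choice of the base

quadraticFloor : ∀ c k₀ → 1 ≤ c → ∀ m → ∃[ k ] (k₀ ≤ k × c * (k * k) ≤ m + c * (k₀ * k₀) ×
  m + c * (k₀ * k₀) < c * (suc k * suc k))
quadraticFloor c k₀ 1≤c zero = k₀ , ℕ.≤-refl , ℕ.≤-refl , growing k₀
  where
  growing : ∀ k → c * (k * k) < c * (suc k * suc k)
  growing k = ℕ.*-monoʳ-< c {{>-nonZero 1≤c}} (ℕ.*-mono-< (ℕ.n<1+n k) (ℕ.n<1+n k))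
quadraticFloor c k₀ 1≤c (suc m) with quadraticFloor c k₀ 1≤c m
... | k , k₀≤k , lower , upper with ℕ.m≤n⇒m<n∨m≡n upper
...   | inj₁ strict = k , k₀≤k , ℕ.m≤n⇒m≤1+n lower , strict
-- The witness is the integer part of the square root of (m + ck₀²)/c. It moves up by one only here,
-- where the incremented numerator has just reached c(k + 1)².
...   | inj₂ exact = suc k , ℕ.m≤n⇒m≤1+n k₀≤k , ℕ.≤-reflexive (sym exact) ,
  subst (_< c * (suc (suc k) * suc (suc k))) (sym exact)
    (ℕ.*-monoʳ-< c {{>-nonZero 1≤c}} (ℕ.*-mono-< (ℕ.n<1+n (suc k)) (ℕ.n<1+n (suc k))))

-- Let k be the integer part of the square root of n/c. Then ck² ≤ n leaves room for every type ℓ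
-- times in each class, and rn ≤ rc(k + 1)² ≤ 4rck² ≤ k³ gives each vertex its own word.
eventuallyRich : ∀ ℓ r t-1 → 1 ≤ ℓ → ∃[ N ] (∀ n → N ≤ n → RichColouring ℓ r n (suc t-1))
eventuallyRich ℓ r t-1 1≤ℓ = c * (k₀ * k₀) , colouring
  where
  t c k₀ : ℕ
  t = suc t-1
  c = ℓ * types 1 t
  -- The last inequality holds as soon as k is at least 4rc. The successor also rules out k = 0.
  k₀ = suc (4 * (r * c))

  1≤c : 1 ≤ c
  1≤c = ℕ.*-mono-≤ 1≤ℓ (>-nonZero⁻¹ _ {{types-nonZero 0 t-1}})

  quadruple : ∀ r c k → r * (c * ((k + k) * (k + k))) ≡ 4 * (r * c) * (k * k)
  quadruple = solve-∀

  cube : ∀ k → k * (k * k) ≡ k ^ 3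
  cube k = cong (λ j → k * (k * j)) (sym (ℕ.*-identityʳ k))

  colouring : ∀ n → c * (k₀ * k₀) ≤ n → RichColouring ℓ r n t
  colouring n N≤n with quadraticFloor c k₀ 1≤c (n ∸ c * (k₀ * k₀))
  ... | suc k-1 , k₀≤k , lower , upper = richColouring {{types-nonZero k-1 t-1}} to from (λ _ → inverseˡ refl)
          (begin
            r * n                              ≤⟨ ℕ.*-monoʳ-≤ r (ℕ.<⇒≤ n<c[1+k]²) ⟩
            r * (c * (suc k * suc k))          ≤⟨ ℕ.*-monoʳ-≤ r (ℕ.*-monoʳ-≤ c (ℕ.*-mono-≤ 1+k≤k+k 1+k≤k+k)) ⟩
            r * (c * ((k + k) * (k + k)))      ≡⟨ quadruple r c k ⟩
            4 * (r * c) * (k * k)              ≤⟨ ℕ.*-monoˡ-≤ (k * k) (ℕ.≤-trans (ℕ.n≤1+n _) k₀≤k) ⟩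
            k * (k * k)                        ≡⟨ cube k ⟩
            k ^ 3                              ∎)
          (begin
            ℓ * types k t                      ≡⟨ cong (ℓ *_) (types-quadratic k t) ⟩
            ℓ * (types 1 t * (k * k))          ≡⟨ ℕ.*-assoc ℓ (types 1 t) (k * k) ⟨
            c * (k * k)                        ≤⟨ lower ⟩
            n ∸ c * (k₀ * k₀) + c * (k₀ * k₀)  ≡⟨ restore ⟩
            n                                  ∎)
    where
    open ℕ.≤-Reasoning
    open Inverse (types↔ (suc k-1) t) using (to; from; inverseˡ)
    k = suc k-1
    restore : n ∸ c * (k₀ * k₀) + c * (k₀ * k₀) ≡ n
    restore = ℕ.m∸n+n≡m N≤n
    n<c[1+k]² : n < c * (suc k * suc k)
    n<c[1+k]² = subst (_< c * (suc k * suc k)) restore upper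
    1+k≤k+k : suc k ≤ k + k
    1+k≤k+k = ℕ.+-monoˡ-≤ k (s≤s z≤n)

-- Trees in finite graphs

elements : ∀ {n} (S : Subset n) →
  ∃[ xs ] (length xs ≡ ∣ S ∣ × Unique xs × (∀ {u} → u ∈ₛ S → u ∈ xs) × (∀ {u} → u ∈ xs → u ∈ₛ S))
elements [] = [] , refl , [] , (λ ()) , λ ()
elements {suc n} (b ∷ S) with elements S
... | xs , len , uniq , to , from = extend b
  where
  zero∉ : ∀ {u} → u ∈ map suc xs → zero {n} ≢ u
  zero∉ u∈ refl with ∈-map⁻ suc u∈
  ... | _ , _ , ()

  shifted : ∀ {b u} → u ∈ map suc xs → u ∈ₛ (b ∷ S)
  shifted u∈ with ∈-map⁻ suc u∈
  ... | v , v∈ , refl = Vec.there (from v∈)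

  extend : ∀ b → ∃[ ys ] (length ys ≡ ∣ b ∷ S ∣ × Unique ys ×
    (∀ {u} → u ∈ₛ (b ∷ S) → u ∈ ys) × (∀ {u} → u ∈ ys → u ∈ₛ (b ∷ S)))
  extend outside = map suc xs , trans (length-map suc xs) len , Unique.map⁺ suc-injective uniq ,
    (λ { (Vec.there u∈) → ∈-map⁺ suc (to u∈) }) , shifted
  extend inside = zero ∷ map suc xs , cong suc (trans (length-map suc xs) len) ,
    All.tabulate zero∉ ∷ Unique.map⁺ suc-injective uniq ,
    (λ { Vec.here → here refl ; (Vec.there u∈) → there (∈-map⁺ suc (to u∈)) }) ,
    λ { (here refl) → Vec.here ; (there u∈) → shifted u∈ }

module _ {A : Set} where
  lookup-distinct : ∀ {xs : List A} → Unique xs → ∀ i j → i Fin.< j → lookup xs i ≢ lookup xs j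
  lookup-distinct (x∉ ∷ _) zero (suc j) _ = All.lookup x∉ (∈-lookup j)
  lookup-distinct (_ ∷ uniq) (suc i) (suc j) (s≤s i<j) = lookup-distinct uniq i j i<j

Unique⇒length≤ : ∀ {n} {xs : List (Fin n)} → Unique xs → length xs ≤ n
Unique⇒length≤ {n} {xs} uniq with length xs ℕ.≤? n
... | yes ≤n = ≤n
... | no ≰n with pigeonhole (ℕ.≰⇒> ≰n) (lookup xs)
...   | i , j , i<j , eq = contradiction eq (lookup-distinct uniq i j i<j)

unique-map⇒injective : ∀ {A B : Set} {f : A → B} {xs} → Unique (map f xs) →
  ∀ {a b} → a ∈ xs → b ∈ xs → f a ≡ f b → a ≡ b
unique-map⇒injective (_ ∷ _) (here refl) (here refl) _ = refl
unique-map⇒injective {f = f} (a∉ ∷ _) (here refl) (there b∈) eq =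
  contradiction eq (All.lookup a∉ (∈-map⁺ f b∈))
unique-map⇒injective {f = f} (b∉ ∷ _) (there a∈) (here refl) eq =
  contradiction (sym eq) (All.lookup b∉ (∈-map⁺ f a∈))
unique-map⇒injective (_ ∷ uniq) (there a∈) (there b∈) eq = unique-map⇒injective uniq a∈ b∈ eq

-- A walk along edges of a ranked forest that never backtracks descends to
-- ancestors first and ascends afterwards, so it cannot close up to a cycle.
module _ {A : Set} {E : Rel A 0ℓ} (E-sym : ∀ {u v} → E u v → E v u) (rank : A → ℕ)
  (rank-≢ : ∀ {u v} → E u v → rank u ≢ rank v)
  (parent-unique : ∀ {u v w} → E u v → E u w → rank v < rank u → rank w < rank u → v ≡ w)
  where

  private
    NonBacktracking : List A → Set
    NonBacktracking (a ∷ b ∷ c ∷ l) = a ≢ c × NonBacktracking (b ∷ c ∷ l)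
    NonBacktracking _ = ⊤

    unique⇒nonBacktracking : ∀ {l} → Unique l → NonBacktracking l
    unique⇒nonBacktracking [] = _
    unique⇒nonBacktracking (_ ∷ []) = _
    unique⇒nonBacktracking (_ ∷ _ ∷ []) = _
    unique⇒nonBacktracking ((_ ∷ a≢c ∷ _) ∷ u@(_ ∷ _ ∷ _)) = a≢c , unique⇒nonBacktracking u

    _≺_ _≻_ : Rel A 0ℓ
    u ≺ v = rank u < rank v
    u ≻ v = rank v < rank u

    step : ∀ {u v} → E u v → u ≺ v ⊎ u ≻ v
    step {u} {v} e with ℕ.<-cmp (rank u) (rank v)
    ... | tri< p _ _ = inj₁ p
    ... | tri≈ _ p _ = contradiction p (rank-≢ e)
    ... | tri> _ _ p = inj₂ p

    -- After a step up from a to b, the only lower neighbour of b is a, so a step down from b would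
    -- backtrack.
    ascending : ∀ {a b l} → Linked E (a ∷ b ∷ l) → NonBacktracking (a ∷ b ∷ l) →
      a ≺ b → Linked _≺_ (a ∷ b ∷ l)
    ascending (_ ∷ [-]) _ a≺b = a≺b ∷ [-]
    ascending (ab ∷ bc ∷ es) (a≢c , nb) a≺b with step bc
    ... | inj₁ b≺c = a≺b ∷ ascending (bc ∷ es) nb b≺c
    ... | inj₂ b≻c = contradiction (parent-unique (E-sym ab) bc a≺b b≻c) a≢c

    EndsWithDescent : List A → Set
    EndsWithDescent (a ∷ b ∷ []) = a ≻ b
    EndsWithDescent (a ∷ b ∷ c ∷ l) = EndsWithDescent (b ∷ c ∷ l)
    EndsWithDescent _ = ⊥

    endsWithDescent : ∀ l {y z} → y ≻ z → EndsWithDescent (l ++ y ∷ z ∷ [])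
    endsWithDescent [] y≻z = y≻z
    endsWithDescent (a ∷ []) y≻z = y≻z
    endsWithDescent (a ∷ b ∷ []) y≻z = y≻z
    endsWithDescent (a ∷ b ∷ c ∷ l) y≻z = endsWithDescent (b ∷ c ∷ l) y≻z

    -- The mirror image of `ascending`, carried backwards from the last step of the walk.
    descending : ∀ {a b l} → Linked E (a ∷ b ∷ l) → NonBacktracking (a ∷ b ∷ l) →
      EndsWithDescent (a ∷ b ∷ l) → Linked _≻_ (a ∷ b ∷ l)
    descending (_ ∷ [-]) _ a≻b = a≻b ∷ [-]
    descending (ab ∷ bc ∷ es) (a≢c , nb) ends with descending (bc ∷ es) nb ends | step ab
    ... | b≻c ∷ ds | inj₁ a≺b = contradiction (parent-unique (E-sym ab) bc a≺b b≻c) a≢c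
    ... | ds       | inj₂ a≻b = a≻b ∷ ds

    first-last : ∀ {R : Rel A 0ℓ} → Transitive R → ∀ a l {z} → Linked R (a ∷ (l ∷ʳ z)) → R a z
    first-last R-trans a l linked with Linked⇒AllPairs R-trans linked
    ... | as ∷ _ = All.lookup as (∈-++⁺ʳ l (here refl))

  -- If the first step goes up, the whole walk ascends; if the last goes down, the whole walk
  -- descends. Either way `x` would have smaller rank than itself. Otherwise the second and the last
  -- vertex of the cycle are both the parent of `x`, although they are distinct.
  forest-acyclic : ∀ x xs → 3 ≤ length (x ∷ xs) → Unique (x ∷ xs) → ¬ Linked E ((x ∷ xs) ∷ʳ x)
  forest-acyclic x [] (s≤s ())
  forest-acyclic x (x₁ ∷ xs) len uniq linked with initLast xs
  forest-acyclic x (x₁ ∷ .[]) (s≤s (s≤s ())) uniq linked | []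
  forest-acyclic x (x₁ ∷ .(ws ∷ʳ y)) len uniq@(x∉ ∷ x₁∉ ∷ uniq′) linked@(x—x₁ ∷ _) | ws ∷ʳ′ y =
    go (step x—x₁) (step y—x)
    where
    closed : List A
    closed = x ∷ x₁ ∷ (ws ∷ʳ y) ∷ʳ x

    reassociate : closed ≡ (x ∷ x₁ ∷ ws) ++ y ∷ x ∷ []
    reassociate = cong (λ l → x ∷ x₁ ∷ l) (++-assoc ws (y ∷ []) (x ∷ []))

    lastEdge : ∀ l {u v} → Linked E (l ++ u ∷ v ∷ []) → E u v
    lastEdge [] (e ∷ _) = e
    lastEdge (_ ∷ l) es = lastEdge l (Linked.tail es)

    y—x : E y x
    y—x = lastEdge (x ∷ x₁ ∷ ws) (subst (Linked E) reassociate linked)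

    -- The list `closed` contains `x` twice, so uniqueness is used for its tail and the first `x` is
    -- put back by hand.
    nonBacktracking : NonBacktracking closed
    nonBacktracking = prepend ws x∉ (unique⇒nonBacktracking (Unique.++⁺ (x₁∉ ∷ uniq′) ([] ∷ [])
      λ { (x∈ , here refl) → All.lookup x∉ x∈ refl }))
      where
      prepend : ∀ ws → All (x ≢_) (x₁ ∷ (ws ∷ʳ y)) → NonBacktracking (x₁ ∷ (ws ∷ʳ y) ∷ʳ x) →
        NonBacktracking (x ∷ x₁ ∷ (ws ∷ʳ y) ∷ʳ x)
      prepend [] (_ ∷ x≢ ∷ _) nb = x≢ , nb
      prepend (w ∷ ws) (_ ∷ x≢ ∷ _) nb = x≢ , nb

    go : x ≺ x₁ ⊎ x ≻ x₁ → y ≺ x ⊎ y ≻ x → ⊥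
    go (inj₁ x≺x₁) _ = ℕ.<-irrefl refl
      (first-last ℕ.<-trans x (x₁ ∷ (ws ∷ʳ y)) (ascending linked nonBacktracking x≺x₁))
    go (inj₂ _) (inj₂ y≻x) = ℕ.<-irrefl refl
      (first-last (λ p q → ℕ.<-trans q p) x (x₁ ∷ (ws ∷ʳ y)) (descending linked nonBacktracking
        (subst EndsWithDescent (sym reassociate) (endsWithDescent (x ∷ x₁ ∷ ws) y≻x))))
    go (inj₂ x≻x₁) (inj₁ y≺x) =
      All.lookup x₁∉ (∈-++⁺ʳ ws (here refl)) (parent-unique x—x₁ (E-sym y—x) x≻x₁ y≺x)

module _ {n : ℕ} where
  fromList : List (Fin n) → Subset n
  fromList xs = ⋃ (map ⁅_⁆ xs)

  ∈-fromList⁺ : ∀ {u} xs → u ∈ xs → u ∈ₛ fromList xs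
  ∈-fromList⁺ (x ∷ _)  (here refl) = x∈p∪q⁺ (inj₁ (x∈⁅x⁆ x))
  ∈-fromList⁺ (_ ∷ xs) (there u∈)  = x∈p∪q⁺ (inj₂ (∈-fromList⁺ xs u∈))

  ∈-fromList⁻ : ∀ {u} xs → u ∈ₛ fromList xs → u ∈ xs
  ∈-fromList⁻ []       u∈ = contradiction u∈ ∉⊥
  ∈-fromList⁻ (x ∷ xs) u∈ with x∈p∪q⁻ ⁅ x ⁆ (fromList xs) u∈
  ... | inj₁ u∈x  = here (x∈⁅y⁆⇒x≡y x u∈x)
  ... | inj₂ u∈xs = there (∈-fromList⁻ xs u∈xs)

-- Trees grown leaf by leaf

module Trees (G : Graph) where
  open Graph G

  -- Newest vertices come first, and each edge is stored once, as a pair of child and parent.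
  data Grown : List Vertex → List (Vertex × Vertex) → Set where
    root : ∀ v → Grown (v ∷ []) []
    leaf : ∀ {vs es w p} → Grown vs es → w ∉ vs → p ∈ vs → Adj w p → Grown (w ∷ vs) ((w , p) ∷ es)

  Joined : List (Vertex × Vertex) → Rel Vertex 0ℓ
  Joined es u v = (u , v) ∈ es ⊎ (v , u) ∈ es

  endpoints : ∀ {vs es} → Grown vs es → ∀ {u v} → (u , v) ∈ es → u ∈ vs × v ∈ vs
  endpoints (leaf g _ p∈ _) (here refl) = here refl , there p∈
  endpoints (leaf g _ _ _) (there e) with endpoints g e
  ... | u∈ , v∈ = there u∈ , there v∈

  joined-endpoints : ∀ {vs es} → Grown vs es → ∀ {u v} → Joined es u v → u ∈ vs × v ∈ vs
  joined-endpoints g (inj₁ e) = endpoints g e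
  joined-endpoints g (inj₂ e) = proj₂ (endpoints g e) , proj₁ (endpoints g e)

  edges-adjacent : ∀ {vs es} → Grown vs es → ∀ {u v} → (u , v) ∈ es → Adj u v
  edges-adjacent (leaf _ _ _ adj) (here refl) = adj
  edges-adjacent (leaf g _ _ _) (there e) = edges-adjacent g e

  parent-unique : ∀ {vs es} → Grown vs es → ∀ {u v w} → (u , v) ∈ es → (u , w) ∈ es → v ≡ w
  parent-unique (leaf g _ _ _) (here refl) (here refl) = refl
  parent-unique (leaf g w∉ _ _) (here refl) (there f) = contradiction (proj₁ (endpoints g f)) w∉
  parent-unique (leaf g w∉ _ _) (there e) (here refl) = contradiction (proj₁ (endpoints g e)) w∉
  parent-unique (leaf g _ _ _) (there e) (there f) = parent-unique g e f

  -- Vertices outside the list get rank 0.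
  rank : List Vertex → Vertex → ℕ
  rank [] u = 0
  rank (w ∷ vs) u = if does (u ≟ w) then suc (length vs) else rank vs u

  rank-≤ : ∀ vs u → rank vs u ≤ length vs
  rank-≤ [] u = z≤n
  rank-≤ (w ∷ vs) u with u ≟ w
  ... | yes _ = ℕ.≤-refl
  ... | no _  = ℕ.m≤n⇒m≤1+n (rank-≤ vs u)

  rank-old : ∀ {w vs u} → w ∉ vs → u ∈ vs → rank (w ∷ vs) u ≡ rank vs u
  rank-old {w} {vs} {u} w∉ u∈ rewrite dec-false (u ≟ w) (λ { refl → w∉ u∈ }) = refl

  -- Ranks record the order of joining, and a parent is present before its child.
  rank-parent : ∀ {vs es} → Grown vs es → ∀ {u v} → (u , v) ∈ es → rank vs v < rank vs u
  rank-parent (leaf {vs} {w = w} {p} g w∉ p∈ _) (here refl)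
    rewrite rank-old w∉ p∈ | dec-true (w ≟ w) refl = s≤s (rank-≤ vs p)
  rank-parent (leaf g w∉ _ _) (there e)
    rewrite rank-old w∉ (proj₁ (endpoints g e)) | rank-old w∉ (proj₂ (endpoints g e)) = rank-parent g e

  toSubgraph : ∀ {vs es} → Grown vs es → Subgraph G
  toSubgraph {vs} {es} g = record
    { vertices = fromList vs
    ; Edge     = Joined es
    ; edge?    = λ u v → ((u , v) ∈? es) ⊎-dec ((v , u) ∈? es)
    ; edge-sym = swap
    ; edge-adj = [ edges-adjacent g , symm ∘ edges-adjacent g ]′
    ; edge-∈   = λ e → let u∈ , v∈ = joined-endpoints g e in ∈-fromList⁺ vs u∈ , ∈-fromList⁺ vs v∈
    }
    where open DecMembership (≡-dec _≟_ _≟_) using (_∈?_)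

  grown-connected : ∀ {vs es} → Grown vs es → ∃[ r ] (r ∈ vs × (∀ {u} → u ∈ vs → Star (Joined es) u r))
  grown-connected (root v) = v , here refl , λ { (here refl) → ε }
  grown-connected (leaf {es = es} {w} {p} g w∉ p∈ _) with grown-connected g
  ... | r , r∈ , path = r , there r∈ , λ
    { (here refl) → inj₁ (here refl) ◅ older (path p∈)
    ; (there u∈)  → older (path u∈) }
    where
    older : ∀ {u v} → Star (Joined es) u v → Star (Joined ((w , p) ∷ es)) u v
    older = Star.map [ inj₁ ∘ there , inj₂ ∘ there ]′

  grown-isTree : ∀ {vs es} (g : Grown vs es) → IsTree (toSubgraph g)
  grown-isTree {vs} {es} g with grown-connected g
  ... | r , r∈ , path = (r , ∈-fromList⁺ vs r∈)
    , (λ u∈ v∈ → path (∈-fromList⁻ vs u∈) ◅◅ Star.reverse swap (path (∈-fromList⁻ vs v∈)))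
    , acyclic
    where
    -- A step down in rank is stored in just that direction, so uniqueness of parents applies to it.
    upward : ∀ {u v} → Joined es u v → rank vs v < rank vs u → (u , v) ∈ es
    upward (inj₁ e) _ = e
    upward (inj₂ e) v<u = contradiction (rank-parent g e) (ℕ.<⇒≯ v<u)

    acyclic : Acyclic (toSubgraph g)
    acyclic (x ∷ xs) (len , uniq , linked) = forest-acyclic swap (rank vs)
      [ (λ e → ℕ.>⇒≢ (rank-parent g e)) , (λ e → ℕ.<⇒≢ (rank-parent g e)) ]′
      (λ e f p q → parent-unique g (upward e p) (upward f q))
      x xs len uniq linked

  module _ {t : ℕ} (col : Vertex → Vertex → Fin t) (col-sym : ∀ u v → col u v ≡ col v u) where

    toColouring : EdgeColouring G t
    toColouring = record { colour = λ u v _ → col u v ; colour-sym = λ {u} {v} _ _ → col-sym u v }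

    edgeColour : Vertex × Vertex → Fin t
    edgeColour (u , v) = col u v

    grown-isRainbow : ∀ {vs es} (g : Grown vs es) → Unique (map edgeColour es) →
      IsRainbow toColouring (toSubgraph g)
    grown-isRainbow g uniq {u} {v} {x} {y} e f eq = compare e f
      where
      same : ∀ {a b} → a ∈ _ → b ∈ _ → edgeColour a ≡ edgeColour b → a ≡ b
      same = unique-map⇒injective uniq

      compare : Joined _ u v → Joined _ x y → (u ≡ x × v ≡ y) ⊎ (u ≡ y × v ≡ x)
      compare (inj₁ e) (inj₁ f) with refl ← same e f eq = inj₁ (refl , refl)
      compare (inj₁ e) (inj₂ f) with refl ← same e f (trans eq (col-sym x y)) = inj₂ (refl , refl)
      compare (inj₂ e) (inj₁ f) with refl ← same e f (trans (col-sym v u) eq) = inj₂ (refl , refl)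
      compare (inj₂ e) (inj₂ f)
        with refl ← same e f (trans (col-sym v u) (trans eq (col-sym x y))) = inj₁ (refl , refl)

    record RainbowTree (xs : List Vertex) : Set where
      field
        {vs}    : List Vertex
        {es}    : List (Vertex × Vertex)
        grown   : Grown vs es
        rainbow : Unique (map edgeColour es)
        spans   : ∀ {u} → u ∈ xs → u ∈ vs

    open RainbowTree

    -- Edge-disjointness is asked for inside `xs` only: a common edge of two trees has common ends,
    -- and these lie in `xs` by `vertexDisjoint`.
    record Packing (ℓ : ℕ) (xs : List Vertex) : Set where
      field
        tree           : Fin ℓ → RainbowTree xs
        vertexDisjoint : ∀ {i j u} → i ≢ j → u ∈ vs (tree i) → u ∈ vs (tree j) → u ∈ xs
        edgeDisjoint   : ∀ {i j u v} → i ≢ j → u ∈ xs → v ∈ xs →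
          Joined (es (tree i)) u v → ¬ Joined (es (tree j)) u v

    packing⇒rainbowColouring : ∀ {ℓ k} → (∀ xs → length xs ≡ k → Unique xs → Packing ℓ xs) →
      IsRainbowColouring k ℓ G toColouring
    packing⇒rainbowColouring {ℓ} packing S ∣S∣≡k with elements S
    ... | xs , len , uniq , to , from = T , isRainbowSTree , internallyDisjoint
      where
      open Packing (packing xs (trans len ∣S∣≡k) uniq)

      T : Fin ℓ → Subgraph G
      T i = toSubgraph (grown (tree i))

      ∈T⁻ : ∀ {u} i → u ∈ₛ Subgraph.vertices (T i) → u ∈ vs (tree i)
      ∈T⁻ i = ∈-fromList⁻ (vs (tree i))

      S⊆T : ∀ i {u} → u ∈ₛ S → u ∈ₛ Subgraph.vertices (T i)
      S⊆T i u∈ = ∈-fromList⁺ (vs (tree i)) (spans (tree i) (to u∈))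

      isRainbowSTree : ∀ i → IsRainbowSTree toColouring S (T i)
      isRainbowSTree i =
        grown-isTree (grown (tree i)) , S⊆T i , grown-isRainbow (grown (tree i)) (rainbow (tree i))

      internallyDisjoint : InternallyDisjoint S T
      internallyDisjoint i j i≢j =
        (λ u v (e , f) → edgeDisjoint i≢j
          (shared (proj₁ (joined-endpoints (grown (tree i)) e)) (proj₁ (joined-endpoints (grown (tree j)) f)))
          (shared (proj₂ (joined-endpoints (grown (tree i)) e)) (proj₂ (joined-endpoints (grown (tree j)) f)))
          e f) ,
        ⊆-antisym
          (λ u∈ → let u∈ᵢ , u∈ⱼ = x∈p∩q⁻ (Subgraph.vertices (T i)) (Subgraph.vertices (T j)) u∈
                  in from (shared (∈T⁻ i u∈ᵢ) (∈T⁻ j u∈ⱼ)))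
          (λ u∈ → x∈p∩q⁺ (S⊆T i u∈ , S⊆T j u∈))
        where
        shared : ∀ {u} → u ∈ vs (tree i) → u ∈ vs (tree j) → u ∈ xs
        shared = vertexDisjoint i≢j

-- Packings of rainbow trees

-- Otherwise the positions of the elements in the list would inject `Fin r` into fewer than r
-- places.
missed : ∀ {r} (cs : List (Fin r)) → length cs < r → ∃[ D ] D ∉ cs
missed {r} cs len with any? (λ D → ¬? (DecMembership._∈?_ _≟_ D cs))
... | yes p = p
... | no ¬p = contradiction (injective⇒≤ {f = index ∘ all∈} injective) (ℕ.<⇒≱ len)
  where
  all∈ : ∀ D → D ∈ cs
  all∈ D = decidable-stable (DecMembership._∈?_ _≟_ D cs) (λ D∉ → ¬p (D , D∉))

  injective : ∀ {D D′} → index (all∈ D) ≡ index (all∈ D′) → D ≡ D′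
  injective {D} {D′} eq = trans (lookup-index (all∈ D))
    (trans (cong (lookup cs) eq) (sym (lookup-index (all∈ D′))))

-- Here δ plays the colour of an edge of the given triple; the lists are ordered like the edge lists
-- of `path₄` and `path₅`.
Completable₃ Completable₄ : ℕ → Set
Completable₃ t = ∀ (δ : Fin t) → ∃[ β ] ∃[ γ ] Unique (γ ∷ β ∷ δ ∷ [])
Completable₄ t = ∀ (δ : Fin t) → ∃[ α ] ∃[ β ] ∃[ γ ] Unique (α ∷ β ∷ γ ∷ δ ∷ [])

abstract
  completable₃ : Completable₃ 3
  completable₃ = from-yes (all? {n = 3} λ δ → any? λ β → any? λ γ → unique? _≟_ (γ ∷ β ∷ δ ∷ []))

  completable₄ : Completable₄ 4
  completable₄ = from-yes (all? {n = 4} λ δ → any? λ α → any? λ β → any? λ γ →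
    unique? _≟_ (α ∷ β ∷ γ ∷ δ ∷ []))

module _ {ℓ r n t : ℕ} (R : RichColouring ℓ r n t) where
  open RichColouring R
  private
    G : Graph
    G = completeMultipartite r n
  open Graph G using (Vertex)
  open Trees G
  open RainbowTree
  open Packing

  private
    Spanning : List Vertex → Set
    Spanning = RainbowTree col col-sym

    class : Vertex → Fin r
    class = quotient {r} n

    apart : ∀ {u v} → class u ≢ class v → u ≢ v
    apart c≢ refl = c≢ refl

    ∉₁ : ∀ {A : Set} {a x : A} → a ≢ x → a ∉ x ∷ []
    ∉₁ p (here e) = p e

    ∉₂ : ∀ {A : Set} {a x y : A} → a ≢ x → a ≢ y → a ∉ x ∷ y ∷ []
    ∉₂ p q (here e) = p e
    ∉₂ p q (there e) = ∉₁ q e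

    ∉₃ : ∀ {A : Set} {a x y z : A} → a ≢ x → a ≢ y → a ≢ z → a ∉ x ∷ y ∷ z ∷ []
    ∉₃ p q s (here e) = p e
    ∉₃ p q s (there e) = ∉₂ q s e

    ∉₄ : ∀ {A : Set} {a x y z w : A} → a ≢ x → a ≢ y → a ≢ z → a ≢ w → a ∉ x ∷ y ∷ z ∷ w ∷ []
    ∉₄ p q s s′ (here e) = p e
    ∉₄ p q s s′ (there e) = ∉₃ q s s′ e

    noInnerEdge : ∀ {xs es} → All (λ (a , b) → a ∉ xs ⊎ b ∉ xs) es →
      ∀ {u v} → u ∈ xs → v ∈ xs → ¬ Joined es u v
    noInnerEdge outer u∈ v∈ (inj₁ e) = [ (λ u∉ → u∉ u∈) , (λ v∉ → v∉ v∈) ]′ (All.lookup outer e)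
    noInnerEdge outer u∈ v∈ (inj₂ e) = [ (λ v∉ → v∉ v∈) , (λ u∉ → u∉ u∈) ]′ (All.lookup outer e)

    module _ {x y z : Vertex} where

      star : ∀ {v} → class x ≢ class v → class y ≢ class v → class z ≢ class v →
        x ≢ y → x ≢ z → y ≢ z → Unique (col z v ∷ col y v ∷ col x v ∷ []) → Spanning (x ∷ y ∷ z ∷ [])
      star {v} xv yv zv x≢y x≢z y≢z uniq = record
        { grown   = leaf (leaf (leaf (root v) (∉₁ (apart xv)) (here refl) xv)
                      (∉₂ (x≢y ∘ sym) (apart yv)) (there (here refl)) yv)
                      (∉₃ (y≢z ∘ sym) (x≢z ∘ sym) (apart zv)) (there (there (here refl))) zv
        ; rainbow = uniq
        ; spans   = λ { (here refl) → there (there (here refl)) ; (there (here refl)) → there (here refl)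
                      ; (there (there (here refl))) → here refl }
        }

      -- The path x-y-v-z, grown from y.
      path₄ : ∀ {v} → class y ≢ class v → class z ≢ class v → class x ≢ class y → x ≢ v →
        x ≢ z → y ≢ z → Unique (col z v ∷ col v y ∷ col x y ∷ []) → Spanning (x ∷ y ∷ z ∷ [])
      path₄ {v} yv zv xy x≢v x≢z y≢z uniq = record
        { grown   = leaf (leaf (leaf (root y) (∉₁ (apart xy)) (here refl) xy)
                      (∉₂ (x≢v ∘ sym) (apart (yv ∘ sym))) (there (here refl)) (yv ∘ sym))
                      (∉₃ (apart zv) (x≢z ∘ sym) (y≢z ∘ sym)) (here refl) zv
        ; rainbow = uniq
        ; spans   = λ { (here refl) → there (there (here refl))
                      ; (there (here refl)) → there (there (there (here refl)))
                      ; (there (there (here refl))) → here refl }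
        }

      -- The path x-v-z-u-y, grown from its middle vertex z.
      path₅ : ∀ {u v} → class x ≢ class v → class z ≢ class v → class z ≢ class u → class y ≢ class u →
        class u ≢ class v → x ≢ u → y ≢ v → x ≢ y → x ≢ z → y ≢ z →
        Unique (col y u ∷ col x v ∷ col u z ∷ col v z ∷ []) → Spanning (x ∷ y ∷ z ∷ [])
      path₅ {u} {v} xv zv zu yu uv x≢u y≢v x≢y x≢z y≢z uniq = record
        { grown   = leaf (leaf (leaf (leaf (root z)
                      (∉₁ (apart (zv ∘ sym))) (here refl) (zv ∘ sym))
                      (∉₂ (apart uv) (apart (zu ∘ sym))) (there (here refl)) (zu ∘ sym))
                      (∉₃ x≢u (apart xv) x≢z) (there (here refl)) xv)
                      (∉₄ (x≢y ∘ sym) (apart yu) y≢v y≢z) (there (here refl)) yu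
        ; rainbow = uniq
        ; spans   = λ { (here refl) → there (here refl) ; (there (here refl)) → here refl
                      ; (there (there (here refl))) → there (there (there (there (here refl)))) }
        }

  starPacking : ∀ {α β γ} → Unique (γ ∷ β ∷ α ∷ []) → ∀ {x y z} → Unique (x ∷ y ∷ z ∷ []) →
    ∀ {D} → D ∉ class x ∷ class y ∷ class z ∷ [] → Packing col col-sym ℓ (x ∷ y ∷ z ∷ [])
  starPacking {α} {β} {γ} colours {x} {y} {z} ((x≢y ∷ x≢z ∷ []) ∷ (y≢z ∷ []) ∷ _) {D} D∉
    with rich D x≢y x≢z y≢z α β γ
  ... | f , f-injective , f-spec = record
    { tree = tree′
    ; vertexDisjoint = vertexDisjoint′
    ; edgeDisjoint = λ {i} _ u∈ v∈ e → contradiction e (noInnerEdge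
        (inj₂ (centre∉ i) ∷ inj₂ (centre∉ i) ∷ inj₂ (centre∉ i) ∷ []) u∈ v∈)
    }
    where
    xs : List Vertex
    xs = x ∷ y ∷ z ∷ []

    class-≢ : ∀ {c} → c ∈ class x ∷ class y ∷ class z ∷ [] → ∀ i → c ≢ class (f i)
    class-≢ c∈ i e = D∉ (subst (_∈ _) (trans e (proj₁ (f-spec i))) c∈)

    xf : ∀ i → class x ≢ class (f i)
    xf = class-≢ (here refl)
    yf : ∀ i → class y ≢ class (f i)
    yf = class-≢ (there (here refl))
    zf : ∀ i → class z ≢ class (f i)
    zf = class-≢ (there (there (here refl)))

    centre∉ : ∀ i → f i ∉ xs
    centre∉ i = ∉₃ (apart (xf i ∘ sym)) (apart (yf i ∘ sym)) (apart (zf i ∘ sym))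

    uniq : ∀ i → Unique (col z (f i) ∷ col y (f i) ∷ col x (f i) ∷ [])
    uniq i with f-spec i
    ... | _ , cx , cy , cz rewrite cx | cy | cz = colours

    tree′ : Fin ℓ → Spanning xs
    tree′ i = star (xf i) (yf i) (zf i) x≢y x≢z y≢z (uniq i)

    inner : ∀ {i u} → u ∈ vs (tree′ i) → u ∈ xs ⊎ u ≡ f i
    inner (here e) = inj₁ (there (there (here e)))
    inner (there (here e)) = inj₁ (there (here e))
    inner (there (there (here e))) = inj₁ (here e)
    inner (there (there (there (here e)))) = inj₂ e

    vertexDisjoint′ : ∀ {i j u} → i ≢ j → u ∈ vs (tree′ i) → u ∈ vs (tree′ j) → u ∈ xs
    vertexDisjoint′ {i} {j} i≢j p q with inner {i} p | inner {j} q
    ... | inj₁ u∈ | _ = u∈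
    ... | inj₂ _ | inj₁ u∈ = u∈
    ... | inj₂ e | inj₂ e′ = contradiction (f-injective (trans (sym e) e′)) i≢j

  module _ {x y z : Vertex} (xy : class x ≢ class y) (xz : class x ≢ class z) (yz : class y ≢ class z) where
    private
      xs : List Vertex
      xs = x ∷ y ∷ z ∷ []
      x≢y : x ≢ y
      x≢y = apart xy
      x≢z : x ≢ z
      x≢z = apart xz
      y≢z : y ≢ z
      y≢z = apart yz

    -- The colours avoid δ = col x y, so u ≢ x and v ≢ y come for free.
    path₅Packing : Completable₄ t → Packing col col-sym ℓ xs
    path₅Packing complete with complete (col x y)
    ... | α , β , γ , colours@((_ ∷ _ ∷ α≢δ ∷ []) ∷ (_ ∷ β≢δ ∷ []) ∷ _)
      -- In both requests the last colour γ is a filler: it concerns the corner in the class of the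
      -- new vertex, to which the path has no edge.
      with rich (class x) y≢z (x≢y ∘ sym) (x≢z ∘ sym) α γ γ
         | rich (class y) x≢z x≢y (y≢z ∘ sym) β (col x y) γ
    ...   | f , f-injective , f-spec | g , g-injective , g-spec = record
      { tree = tree′
      ; vertexDisjoint = vertexDisjoint′
      ; edgeDisjoint = λ {i} _ u∈ v∈ e → contradiction e (noInnerEdge
          (inj₂ (f∉ i) ∷ inj₂ (g∉ i) ∷ inj₁ (f∉ i) ∷ inj₁ (g∉ i) ∷ []) u∈ v∈)
      }
      where
      classf : ∀ i → class (f i) ≡ class x
      classf i = proj₁ (f-spec i)
      classg : ∀ i → class (g i) ≡ class y
      classg i = proj₁ (g-spec i)

      x≢f : ∀ i → x ≢ f i
      x≢f i e = α≢δ (trans (sym (proj₁ (proj₂ (f-spec i)))) (trans (cong (col y) (sym e)) (col-sym y x)))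
      y≢g : ∀ i → y ≢ g i
      y≢g i e = β≢δ (trans (sym (proj₁ (proj₂ (g-spec i)))) (cong (col x) (sym e)))

      yf : ∀ i → class y ≢ class (f i)
      yf i e = xy (trans (sym (classf i)) (sym e))
      zf : ∀ i → class z ≢ class (f i)
      zf i e = xz (trans (sym (classf i)) (sym e))
      xg : ∀ i → class x ≢ class (g i)
      xg i e = xy (trans e (classg i))
      zg : ∀ i → class z ≢ class (g i)
      zg i e = yz (trans (sym (classg i)) (sym e))
      fg : ∀ i j → class (f i) ≢ class (g j)
      fg i j e = xy (trans (sym (classf i)) (trans e (classg j)))

      f∉ : ∀ i → f i ∉ xs
      f∉ i = ∉₃ (x≢f i ∘ sym) (apart (yf i ∘ sym)) (apart (zf i ∘ sym))
      g∉ : ∀ i → g i ∉ xs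
      g∉ i = ∉₃ (apart (xg i ∘ sym)) (y≢g i ∘ sym) (apart (zg i ∘ sym))

      uniq : ∀ i → Unique (col y (f i) ∷ col x (g i) ∷ col (f i) z ∷ col (g i) z ∷ [])
      uniq i with f-spec i | g-spec i
      ... | _ , yf , zf , _ | _ , xg , zg , _
        rewrite yf | xg | col-sym (f i) z | zf | col-sym (g i) z | zg = colours

      tree′ : Fin ℓ → Spanning xs
      tree′ i = path₅ (xg i) (zg i) (zf i) (yf i) (fg i i) (x≢f i) (y≢g i) x≢y x≢z y≢z (uniq i)

      inner : ∀ {i u} → u ∈ vs (tree′ i) → u ∈ xs ⊎ u ≡ f i ⊎ u ≡ g i
      inner (here e) = inj₁ (there (here e))
      inner (there (here e)) = inj₁ (here e)
      inner (there (there (here e))) = inj₂ (inj₁ e)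
      inner (there (there (there (here e)))) = inj₂ (inj₂ e)
      inner (there (there (there (there (here e))))) = inj₁ (there (there (here e)))

      vertexDisjoint′ : ∀ {i j u} → i ≢ j → u ∈ vs (tree′ i) → u ∈ vs (tree′ j) → u ∈ xs
      vertexDisjoint′ {i} {j} i≢j p q with inner {i} p | inner {j} q
      ... | inj₁ u∈ | _ = u∈
      ... | inj₂ _ | inj₁ u∈ = u∈
      ... | inj₂ (inj₁ e) | inj₂ (inj₁ e′) = contradiction (f-injective (trans (sym e) e′)) i≢j
      ... | inj₂ (inj₁ e) | inj₂ (inj₂ e′) = contradiction (cong class (trans (sym e) e′)) (fg i j)
      ... | inj₂ (inj₂ e) | inj₂ (inj₁ e′) = contradiction (cong class (trans (sym e′) e)) (fg j i)
      ... | inj₂ (inj₂ e) | inj₂ (inj₂ e′) = contradiction (g-injective (trans (sym e) e′)) i≢j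

    module _ (1≤ℓ : 1 ≤ ℓ) (complete : Completable₃ t) where
      private
        -- A path a-b-tip-c, whose only edge inside the triple is ab. The class of the tip keeps the
        -- three rotations from sharing tips.
        record Ear (a b c : Vertex) : Set where
          field
            tip       : Vertex
            tip-class : class tip ≡ class a
            earTree   : Spanning (a ∷ b ∷ c ∷ [])
            inner     : ∀ {u} → u ∈ vs earTree → u ∈ a ∷ b ∷ c ∷ [] ⊎ u ≡ tip
            innerEdge : ∀ {u w} → u ∈ a ∷ b ∷ c ∷ [] → w ∈ a ∷ b ∷ c ∷ [] →
              Joined (es earTree) u w → u ∈ a ∷ b ∷ [] × w ∈ a ∷ b ∷ []
        open Ear

        -- As col v b differs from col a b, the tip v cannot be a itself.
        ear : ∀ {a b c} → class a ≢ class b → class a ≢ class c → class b ≢ class c → Ear a b c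
        ear {a} {b} {c} ab ac bc with complete (col a b)
        ... | β , γ , colours@((_ ∷ _) ∷ (β≢δ ∷ []) ∷ _)
          -- The second γ is a filler, as a and the tip lie in one class. A single tip is taken from
          -- the ℓ on offer.
          with rich (class a) (apart bc) (apart (ab ∘ sym)) (apart (ac ∘ sym)) β γ γ
        ... | f , _ , f-spec with f (inject≤ zero 1≤ℓ) | f-spec (inject≤ zero 1≤ℓ)
        ... | v | v-class , bv , cv , _ = record
          { tip = v
          ; tip-class = v-class
          ; earTree = path₄ b≁v c≁v ab a≢v (apart ac) (apart bc) uniq
          ; inner = λ
            { (here e) → inj₁ (there (there (here e)))
            ; (there (here e)) → inj₂ e
            ; (there (there (here e))) → inj₁ (here e)
            ; (there (there (there (here e)))) → inj₁ (there (here e)) }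
          ; innerEdge = λ
            { u∈ w∈ (inj₁ (here refl)) → contradiction w∈ v∉
            ; u∈ w∈ (inj₂ (here refl)) → contradiction u∈ v∉
            ; u∈ w∈ (inj₁ (there (here refl))) → contradiction u∈ v∉
            ; u∈ w∈ (inj₂ (there (here refl))) → contradiction w∈ v∉
            ; u∈ w∈ (inj₁ (there (there (here refl)))) → here refl , there (here refl)
            ; u∈ w∈ (inj₂ (there (there (here refl)))) → there (here refl) , here refl }
          }
          where
          b≁v : class b ≢ class v
          b≁v e = ab (sym (trans e v-class))
          c≁v : class c ≢ class v
          c≁v e = ac (sym (trans e v-class))
          a≢v : a ≢ v
          a≢v refl = β≢δ (trans (sym bv) (col-sym b v))
          v∉ : v ∉ a ∷ b ∷ c ∷ []
          v∉ = ∉₃ (a≢v ∘ sym) (apart (b≁v ∘ sym)) (apart (c≁v ∘ sym))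
          uniq : Unique (col c v ∷ col v b ∷ col a b ∷ [])
          uniq rewrite cv | col-sym v b | bv = colours

        rotate : ∀ {a b c u : Vertex} → u ∈ a ∷ b ∷ c ∷ [] → u ∈ b ∷ c ∷ a ∷ []
        rotate (here e) = there (there (here e))
        rotate (there (here e)) = here e
        rotate (there (there (here e))) = there (here e)

        respan : ∀ {ys} → (∀ {u} → u ∈ xs → u ∈ ys) → Spanning ys → Spanning xs
        respan xs⊆ys T = record { grown = grown T ; rainbow = rainbow T ; spans = spans T ∘ xs⊆ys }

        earˣ : Ear x y z
        earˣ = ear xy xz yz
        earʸ : Ear y z x
        earʸ = ear yz (xy ∘ sym) (xz ∘ sym)
        earᶻ : Ear z x y
        earᶻ = ear (xz ∘ sym) (yz ∘ sym) xy

        earTrees : Fin 3 → Spanning xs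
        earTrees zero = earTree earˣ
        earTrees (suc zero) = respan rotate (earTree earʸ)
        earTrees (suc (suc zero)) = respan (rotate ∘ rotate) (earTree earᶻ)

        sharedVertex : ∀ {a b c a′ b′ c′ u} (E : Ear a b c) (E′ : Ear a′ b′ c′) → class a ≢ class a′ →
          u ∈ vs (earTree E) → u ∈ vs (earTree E′) → u ∈ a ∷ b ∷ c ∷ [] ⊎ u ∈ a′ ∷ b′ ∷ c′ ∷ []
        sharedVertex E E′ aa′ p q with inner E p | inner E′ q
        ... | inj₁ u∈ | _ = inj₁ u∈
        ... | inj₂ _ | inj₁ u∈ = inj₂ u∈
        ... | inj₂ refl | inj₂ e′ =
          contradiction (trans (sym (tip-class E)) (trans (cong class e′) (tip-class E′))) aa′

        -- Inside the triple the first tree has only the edge ab and the second only bc, so a common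
        -- edge would be a loop at b.
        sharedEdge : ∀ {a b c u w} (E : Ear a b c) (E′ : Ear b c a) → class a ≢ class b → class a ≢ class c →
          u ∈ a ∷ b ∷ c ∷ [] → w ∈ a ∷ b ∷ c ∷ [] →
          Joined (es (earTree E)) u w → ¬ Joined (es (earTree E′)) u w
        sharedEdge {a} {b} {c} E E′ ab ac u∈ w∈ e e′
          with innerEdge E u∈ w∈ e | innerEdge E′ (rotate u∈) (rotate w∈) e′
        ... | u∈ab , w∈ab | u∈bc , w∈bc = Graph.irrefl G (trans (common u∈ab u∈bc) (sym (common w∈ab w∈bc)))
                (Subgraph.edge-adj (toSubgraph (grown (earTree E))) e)
          where
          common : ∀ {u} → u ∈ a ∷ b ∷ [] → u ∈ b ∷ c ∷ [] → u ≡ b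
          common (there (here e)) _ = e
          common (here refl) p = contradiction p (∉₂ (apart ab) (apart ac))

      path₄Packing : Packing col col-sym 3 xs
      path₄Packing = record
        { tree = earTrees
        ; vertexDisjoint = λ {i} {j} → vertexDisjoint′ i j
        ; edgeDisjoint = λ {i} {j} → edgeDisjoint′ i j
        }
        where
        back : ∀ {a b c u : Vertex} → u ∈ b ∷ c ∷ a ∷ [] → u ∈ a ∷ b ∷ c ∷ []
        back = rotate ∘ rotate

        vertexDisjoint′ : ∀ i j {u} → i ≢ j → u ∈ vs (earTrees i) → u ∈ vs (earTrees j) → u ∈ xs
        vertexDisjoint′ zero zero i≢j p q = contradiction refl i≢j
        vertexDisjoint′ (suc zero) (suc zero) i≢j p q = contradiction refl i≢j
        vertexDisjoint′ (suc (suc zero)) (suc (suc zero)) i≢j p q = contradiction refl i≢j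
        vertexDisjoint′ zero (suc zero) _ p q = [ id , back ]′ (sharedVertex earˣ earʸ xy p q)
        vertexDisjoint′ (suc zero) zero _ p q = [ back , id ]′ (sharedVertex earʸ earˣ (xy ∘ sym) p q)
        vertexDisjoint′ zero (suc (suc zero)) _ p q = [ id , rotate ]′ (sharedVertex earˣ earᶻ xz p q)
        vertexDisjoint′ (suc (suc zero)) zero _ p q = [ rotate , id ]′ (sharedVertex earᶻ earˣ (xz ∘ sym) p q)
        vertexDisjoint′ (suc zero) (suc (suc zero)) _ p q =
          [ back , rotate ]′ (sharedVertex earʸ earᶻ yz p q)
        vertexDisjoint′ (suc (suc zero)) (suc zero) _ p q =
          [ rotate , back ]′ (sharedVertex earᶻ earʸ (yz ∘ sym) p q)

        edgeDisjoint′ : ∀ i j {u w} → i ≢ j → u ∈ xs → w ∈ xs →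
          Joined (es (earTrees i)) u w → ¬ Joined (es (earTrees j)) u w
        edgeDisjoint′ zero zero i≢j _ _ _ _ = i≢j refl
        edgeDisjoint′ (suc zero) (suc zero) i≢j _ _ _ _ = i≢j refl
        edgeDisjoint′ (suc (suc zero)) (suc (suc zero)) i≢j _ _ _ _ = i≢j refl
        edgeDisjoint′ zero (suc zero) _ u∈ w∈ e e′ = sharedEdge earˣ earʸ xy xz u∈ w∈ e e′
        edgeDisjoint′ (suc zero) zero _ u∈ w∈ e e′ = sharedEdge earˣ earʸ xy xz u∈ w∈ e′ e
        edgeDisjoint′ (suc zero) (suc (suc zero)) _ u∈ w∈ e e′ =
          sharedEdge earʸ earᶻ yz (xy ∘ sym) (rotate u∈) (rotate w∈) e e′
        edgeDisjoint′ (suc (suc zero)) (suc zero) _ u∈ w∈ e e′ =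
          sharedEdge earʸ earᶻ yz (xy ∘ sym) (rotate u∈) (rotate w∈) e′ e
        edgeDisjoint′ (suc (suc zero)) zero _ u∈ w∈ e e′ =
          sharedEdge earᶻ earˣ (xz ∘ sym) (yz ∘ sym) (back u∈) (back w∈) e e′
        edgeDisjoint′ zero (suc (suc zero)) _ u∈ w∈ e e′ =
          sharedEdge earᶻ earˣ (xz ∘ sym) (yz ∘ sym) (back u∈) (back w∈) e′ e

  restrict : ∀ {m k xs} → m ≤ k → Packing col col-sym k xs → Packing col col-sym m xs
  restrict m≤k P = record
    { tree = λ i → tree P (inject≤ i m≤k)
    ; vertexDisjoint = λ i≢j → vertexDisjoint P (i≢j ∘ inject≤-injective m≤k m≤k _ _)
    ; edgeDisjoint = λ i≢j → edgeDisjoint P (i≢j ∘ inject≤-injective m≤k m≤k _ _)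
    }

  -- Two vertices in one class leave at most two classes met by the triple; one of the r ≥ 3 classes
  -- is then free for the centres of stars.
  packing⊎transversal : ∀ {α β γ} → Unique (γ ∷ β ∷ α ∷ []) → 3 ≤ r → ∀ {x y z} → Unique (x ∷ y ∷ z ∷ []) →
    Packing col col-sym ℓ (x ∷ y ∷ z ∷ []) ⊎ (class x ≢ class y × class x ≢ class z × class y ≢ class z)
  packing⊎transversal colours 3≤r {x} {y} {z} uniq
    with class x ≟ class y | class x ≟ class z | class y ≟ class z
  ... | no xy | no xz | no yz = inj₂ (xy , xz , yz)
  ... | yes xy | _ | _ with missed (class x ∷ class z ∷ []) 3≤r
  ...   | D , D∉ = inj₁ (starPacking colours uniq
            (∉₃ (D∉ ∘ here) (λ e → D∉ (here (trans e (sym xy)))) (D∉ ∘ there ∘ here)))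
  packing⊎transversal colours 3≤r {x} {y} {z} uniq | no _ | yes xz | _ with missed (class x ∷ class y ∷ []) 3≤r
  ...   | D , D∉ = inj₁ (starPacking colours uniq
            (∉₃ (D∉ ∘ here) (D∉ ∘ there ∘ here) (λ e → D∉ (here (trans e (sym xz))))))
  packing⊎transversal colours 3≤r {x} {y} {z} uniq | no _ | no _ | yes yz with missed (class x ∷ class y ∷ []) 3≤r
  ...   | D , D∉ = inj₁ (starPacking colours uniq
            (∉₃ (D∉ ∘ here) (D∉ ∘ there ∘ here) (λ e → D∉ (there (here (trans e (sym yz)))))))

  private
    colourable : ∀ {m} → (∀ {x y z} → Unique (x ∷ y ∷ z ∷ []) → Packing col col-sym m (x ∷ y ∷ z ∷ [])) →
      RainbowColourable 3 m G t
    colourable packing = toColouring col col-sym ,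
      packing⇒rainbowColouring col col-sym λ { (x ∷ y ∷ z ∷ []) refl uniq → packing uniq }

  colourable-r≥4 : ∀ {α β γ} → Unique (γ ∷ β ∷ α ∷ []) → 4 ≤ r → RainbowColourable 3 ℓ G t
  colourable-r≥4 colours 4≤r = colourable λ {x} {y} {z} uniq →
    starPacking colours uniq (proj₂ (missed (class x ∷ class y ∷ class z ∷ []) 4≤r))

  colourable-t≥4 : Completable₄ t → Fin t → 3 ≤ r → RainbowColourable 3 ℓ G t
  colourable-t≥4 complete δ 3≤r with complete δ
  ... | _ , _ , _ , (_ ∷ colours) = colourable λ uniq →
    [ id , (λ (xy , xz , yz) → path₅Packing xy xz yz complete) ]′ (packing⊎transversal colours 3≤r uniq)

  colourable-ℓ≤3 : Completable₃ t → Fin t → 3 ≤ r → 1 ≤ ℓ → ℓ ≤ 3 → RainbowColourable 3 ℓ G t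
  colourable-ℓ≤3 complete δ 3≤r 1≤ℓ ℓ≤3 with complete δ
  ... | _ , _ , colours = colourable λ uniq →
    [ id , (λ (xy , xz , yz) → restrict ℓ≤3 (path₄Packing xy xz yz 1≤ℓ complete)) ]′
      (packing⊎transversal colours 3≤r uniq)

-- Lower bounds

∣⁅x⁆∪p∣ : ∀ {n} {x : Fin n} (p : Subset n) → x ∉ₛ p → ∣ ⁅ x ⁆ ∪ p ∣ ≡ suc ∣ p ∣
∣⁅x⁆∪p∣ {x = zero} (inside ∷ p) x∉ = contradiction Vec.here x∉
∣⁅x⁆∪p∣ {x = zero} (outside ∷ p) x∉ = cong (suc ∘ ∣_∣) (∪-identityˡ p)
∣⁅x⁆∪p∣ {x = suc x} (inside ∷ p) x∉ = cong suc (∣⁅x⁆∪p∣ p (x∉ ∘ Vec.there))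
∣⁅x⁆∪p∣ {x = suc x} (outside ∷ p) x∉ = ∣⁅x⁆∪p∣ p (x∉ ∘ Vec.there)

∣fromList∣ : ∀ {n} {xs : List (Fin n)} → Unique xs → ∣ fromList xs ∣ ≡ length xs
∣fromList∣ {n} [] = ∣⊥∣≡0 n
∣fromList∣ {xs = x ∷ xs} (x∉ ∷ uniq) = trans
  (∣⁅x⁆∪p∣ (fromList xs) λ x∈ → All.lookup x∉ (∈-fromList⁻ xs x∈) refl)
  (cong suc (∣fromList∣ uniq))

closed-under-walks : ∀ {A : Set} {E : Rel A 0ℓ} {P : A → Set} → (∀ {u v} → E u v → P u → P v) →
  ∀ {u v} → Star E u v → P u → P v
closed-under-walks closed ε p = p
closed-under-walks closed (e ◅ es) p = closed-under-walks closed es (closed e p)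

module _ {G : Graph} where
  open Graph G

  Same : (Vertex × Vertex) → (Vertex × Vertex) → Set
  Same (u , v) (x , y) = (u ≡ x × v ≡ y) ⊎ (u ≡ y × v ≡ x)

  same? : ∀ e f → Dec (Same e f)
  same? (u , v) (x , y) = ((u ≟ x) ×-dec (v ≟ y)) ⊎-dec ((u ≟ y) ×-dec (v ≟ x))

  module _ {t : ℕ} {c : EdgeColouring G t} {T : Subgraph G} where
    open Subgraph T

    EdgeOf : Set
    EdgeOf = Σ[ u ∈ Vertex ] Σ[ v ∈ Vertex ] Edge u v

    -- Distinct edges of a rainbow tree have distinct colours, so their colours form a
    -- duplicate-free list in `Fin t`.
    rainbow⇒length≤ : IsRainbow c T → (es : List EdgeOf) →
      AllPairs (λ (u , v , _) (x , y , _) → ¬ Same (u , v) (x , y)) es → length es ≤ t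
    rainbow⇒length≤ rainbow es distinct = subst (_≤ t) (length-map hue es)
      (Unique⇒length≤ (AllPairs.map⁺ (AllPairs.map (λ {e} {f} → hue-≢ e f) distinct)))
      where
      hue : EdgeOf → Fin t
      hue (u , v , e) = EdgeColouring.colour c u v (edge-adj e)

      hue-≢ : ∀ e f → ¬ Same (proj₁ e , proj₁ (proj₂ e)) (proj₁ f , proj₁ (proj₂ f)) → hue e ≢ hue f
      hue-≢ (_ , _ , e) (_ , _ , f) e≁f eq = e≁f (rainbow e f eq)

    module _ {x y z : Vertex} (tree : IsRainbowSTree c (fromList (x ∷ y ∷ z ∷ [])) T)
      (uniq : Unique (x ∷ y ∷ z ∷ []))
      (independent : ∀ {u v} → u ∈ x ∷ y ∷ z ∷ [] → v ∈ x ∷ y ∷ z ∷ [] → ¬ Edge u v) where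
      private
        xs : List Vertex
        xs = x ∷ y ∷ z ∷ []

        rainbow : IsRainbow c T
        rainbow = proj₂ (proj₂ tree)

        walk : ∀ {u v} → u ∈ xs → v ∈ xs → Star Edge u v
        walk u∈ v∈ = proj₁ (proj₂ (proj₁ tree))
          (proj₁ (proj₂ tree) (∈-fromList⁺ xs u∈)) (proj₁ (proj₂ tree) (∈-fromList⁺ xs v∈))

        neighbour : ∀ {u v} → u ∈ xs → v ∈ xs → u ≢ v → ∃[ w ] (Edge u w × w ∉ xs)
        neighbour u∈ v∈ u≢v with walk u∈ v∈
        ... | ε = contradiction refl u≢v
        ... | e ◅ _ = _ , e , λ w∈ → independent u∈ w∈ e

        x≢y : x ≢ y
        x≢y = All.lookup (AllPairs.head uniq) (here refl)
        x≢z : x ≢ z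
        x≢z = All.lookup (AllPairs.head uniq) (there (here refl))
        y≢z : y ≢ z
        y≢z = All.lookup (AllPairs.head (AllPairs.tail uniq)) (here refl)

        x∈ : x ∈ xs
        x∈ = here refl
        y∈ : y ∈ xs
        y∈ = there (here refl)
        z∈ : z ∈ xs
        z∈ = there (there (here refl))

        outward-distinct : ∀ {a b u v} → a ∈ xs → a ≢ b → v ∉ xs → ¬ Same (a , u) (b , v)
        outward-distinct a∈ a≢b v∉ (inj₁ (e , _)) = a≢b e
        outward-distinct a∈ a≢b v∉ (inj₂ (refl , _)) = v∉ a∈

        u v w : Vertex
        u = proj₁ (neighbour x∈ y∈ x≢y)
        v = proj₁ (neighbour y∈ x∈ (x≢y ∘ sym))
        w = proj₁ (neighbour z∈ x∈ (x≢z ∘ sym))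
        x—u : Edge x u
        x—u = proj₁ (proj₂ (neighbour x∈ y∈ x≢y))
        y—v : Edge y v
        y—v = proj₁ (proj₂ (neighbour y∈ x∈ (x≢y ∘ sym)))
        z—w : Edge z w
        z—w = proj₁ (proj₂ (neighbour z∈ x∈ (x≢z ∘ sym)))
        u∉ : u ∉ xs
        u∉ = proj₂ (proj₂ (neighbour x∈ y∈ x≢y))
        v∉ : v ∉ xs
        v∉ = proj₂ (proj₂ (neighbour y∈ x∈ (x≢y ∘ sym)))
        w∉ : w ∉ xs
        w∉ = proj₂ (proj₂ (neighbour z∈ x∈ (x≢z ∘ sym)))

        outward : List EdgeOf
        outward = (x , u , x—u) ∷ (y , v , y—v) ∷ (z , w , z—w) ∷ []

        outward-pairwise : AllPairs (λ (u , v , _) (x , y , _) → ¬ Same (u , v) (x , y)) outward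
        outward-pairwise = (outward-distinct x∈ x≢y v∉ ∷ outward-distinct x∈ x≢z w∉ ∷ []) ∷
          (outward-distinct y∈ y≢z w∉ ∷ []) ∷ [] ∷ []

      -- Each vertex of the triple starts a walk to another one, and the first edge leaves the
      -- triple. These three edges are distinct because each has just one end in the triple.
      independent⇒3≤t : 3 ≤ t
      independent⇒3≤t = rainbow⇒length≤ rainbow outward outward-pairwise

      private
        -- With at most three colours there is no room for a fourth edge.
        cover : t ≤ 3 → ∀ {a b} → Edge a b → Same (a , b) (x , u) ⊎ Same (a , b) (y , v) ⊎ Same (a , b) (z , w)
        cover t≤3 {a} {b} e with same? (a , b) (x , u) | same? (a , b) (y , v) | same? (a , b) (z , w)
        ... | yes p | _ | _ = inj₁ p
        ... | no _ | yes p | _ = inj₂ (inj₁ p)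
        ... | no _ | no _ | yes p = inj₂ (inj₂ p)
        ... | no p | no q | no s = contradiction
          (ℕ.≤-trans (rainbow⇒length≤ rainbow ((a , b , e) ∷ outward) ((p ∷ q ∷ s ∷ []) ∷ outward-pairwise)) t≤3)
          ℕ.1+n≰n

        -- Otherwise {a, p} would be a connected component.
        sharesNeighbour : ∀ {a b c p q s} → a ∈ xs → b ∈ xs → c ∈ xs → p ∉ xs → q ∉ xs → s ∉ xs →
          a ≢ b → a ≢ c →
          (∀ {g h} → Edge g h → Same (g , h) (a , p) ⊎ Same (g , h) (b , q) ⊎ Same (g , h) (c , s)) →
          p ≡ q ⊎ p ≡ s
        sharesNeighbour {a} {b} {c} {p} {q} {s} a∈ b∈ c∈ p∉ q∉ s∉ a≢b a≢c covered with p ≟ q | p ≟ s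
        ... | yes e | _ = inj₁ e
        ... | no _ | yes e = inj₂ e
        ... | no p≢q | no p≢s = contradiction
          (closed-under-walks {P = λ h → h ≡ a ⊎ h ≡ p} closed (walk a∈ b∈) (inj₁ refl))
          [ a≢b ∘ sym , (λ { refl → p∉ b∈ }) ]′
          where
          isolated : ∀ {g h d m} → d ∈ xs → m ∉ xs → a ≢ d → p ≢ m → Same (g , h) (d , m) → ¬ (g ≡ a ⊎ g ≡ p)
          isolated d∈ m∉ a≢d p≢m (inj₁ (refl , _)) (inj₁ e) = a≢d (sym e)
          isolated d∈ m∉ a≢d p≢m (inj₁ (refl , _)) (inj₂ refl) = p∉ d∈
          isolated d∈ m∉ a≢d p≢m (inj₂ (refl , _)) (inj₁ refl) = m∉ a∈
          isolated d∈ m∉ a≢d p≢m (inj₂ (refl , _)) (inj₂ e) = p≢m (sym e)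

          closed : ∀ {g h} → Edge g h → g ≡ a ⊎ g ≡ p → h ≡ a ⊎ h ≡ p
          closed e g∈ with covered e
          ... | inj₁ (inj₁ (_ , h≡p)) = inj₂ h≡p
          ... | inj₁ (inj₂ (_ , h≡a)) = inj₁ h≡a
          ... | inj₂ (inj₁ same) = contradiction g∈ (isolated b∈ q∉ a≢b p≢q same)
          ... | inj₂ (inj₂ same) = contradiction g∈ (isolated c∈ s∉ a≢c p≢s same)

        rotate⊎ : ∀ {A B C : Set} → A ⊎ B ⊎ C → B ⊎ C ⊎ A
        rotate⊎ (inj₁ a) = inj₂ (inj₂ a)
        rotate⊎ (inj₂ (inj₁ b)) = inj₁ b
        rotate⊎ (inj₂ (inj₂ c)) = inj₂ (inj₁ c)

        hub : u ≡ v → u ≡ w → ∃[ h ] (Edge x h × Edge y h × Edge z h)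
        hub u≡v u≡w = u , x—u , subst (Edge y) (sym u≡v) y—v , subst (Edge z) (sym u≡w) z—w

      -- Each of `u`, `v`, `w` equals one of the other two, which forces all three to coincide.
      commonNeighbour : t ≤ 3 → ∃[ h ] (Edge x h × Edge y h × Edge z h)
      commonNeighbour t≤3
        with sharesNeighbour x∈ y∈ z∈ u∉ v∉ w∉ x≢y x≢z (cover t≤3)
           | sharesNeighbour y∈ z∈ x∈ v∉ w∉ u∉ y≢z (x≢y ∘ sym) (rotate⊎ ∘ cover t≤3)
           | sharesNeighbour z∈ x∈ y∈ w∉ u∉ v∉ (x≢z ∘ sym) (y≢z ∘ sym) (rotate⊎ ∘ rotate⊎ ∘ cover t≤3)
      ... | inj₁ u≡v | _ | inj₁ w≡u = hub u≡v (sym w≡u)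
      ... | inj₁ u≡v | _ | inj₂ w≡v = hub u≡v (trans u≡v (sym w≡v))
      ... | inj₂ u≡w | inj₁ v≡w | _ = hub (trans u≡w (sym v≡w)) u≡w
      ... | inj₂ u≡w | inj₂ v≡u | _ = hub (sym v≡u) u≡w

module _ {r n : ℕ} where
  private
    G : Graph
    G = completeMultipartite r n
  open Graph G using (Vertex)

  private
    class : Vertex → Fin r
    class = quotient {r} n

    class-combine : ∀ (D : Fin r) (j : Fin n) → class (combine D j) ≡ D
    class-combine D j = cong proj₁ (remQuot-combine D j)

  -- Three vertices of a single class span no edge, so any tree on them already needs three colours.
  colourable⇒3≤ : ∀ {ℓ t} → Fin r → 3 ≤ n → 1 ≤ ℓ → RainbowColourable 3 ℓ G t → 3 ≤ t
  colourable⇒3≤ {suc ℓ} D 3≤n _ (c , rainbowColouring) =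
    independent⇒3≤t {c = c} (proj₁ (proj₂ trees) zero) uniq
      (λ u∈ v∈ e → Subgraph.edge-adj (proj₁ trees zero) e (trans (class-D u∈) (sym (class-D v∈))))
    where
    xs : List Vertex
    xs = map (λ i → combine D (inject≤ i 3≤n)) (zero ∷ suc zero ∷ suc (suc zero) ∷ [])

    differ : ∀ {i j} → i ≢ j → combine D (inject≤ i 3≤n) ≢ combine D (inject≤ j 3≤n)
    differ i≢j e = i≢j (inject≤-injective 3≤n 3≤n _ _ (proj₂ (combine-injective D _ D _ e)))

    uniq : Unique xs
    uniq = (differ (λ ()) ∷ differ (λ ()) ∷ []) ∷ (differ (λ ()) ∷ []) ∷ [] ∷ []

    class-D : ∀ {u} → u ∈ xs → class u ≡ D
    class-D (here refl) = class-combine D _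
    class-D (there (here refl)) = class-combine D _
    class-D (there (there (here refl))) = class-combine D _

    trees = rainbowColouring (fromList xs) (∣fromList∣ uniq)

-- With three colours every tree on such a triple contains an edge of the
-- triangle, so at most three of the trees are edge-disjoint.
module _ {G : Graph} (corner : Fin 3 → Graph.Vertex G)
  (corner-injective : ∀ {i j} → corner i ≡ corner j → i ≡ j)
  (noCommonNeighbour : ∀ h → ∃[ i ] ¬ Graph.Adj G (corner i) h) where
  open Graph G using (irrefl)

  noCommonNeighbour⇒4≤ : ∀ {ℓ t} → 4 ≤ ℓ → RainbowColourable 3 ℓ G t → 4 ≤ t
  noCommonNeighbour⇒4≤ {ℓ} {t} 4≤ℓ (c , rainbowColouring) with 4 ℕ.≤? t
  ... | yes 4≤t = 4≤t
  -- Read as 3 < ℓ, the bound `4≤ℓ` gives more trees than triangle edges, so two trees pick the same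
  -- one.
  ... | no 4≰t = contradiction (pigeonhole 4≤ℓ (proj₁ ∘ triangleEdge)) noSharedEdge
    where
    xs : List (Graph.Vertex G)
    xs = map corner (zero ∷ suc zero ∷ suc (suc zero) ∷ [])

    differ : ∀ {i j} → i ≢ j → corner i ≢ corner j
    differ i≢j e = i≢j (corner-injective e)

    uniq : Unique xs
    uniq = (differ (λ ()) ∷ differ (λ ()) ∷ []) ∷ (differ (λ ()) ∷ []) ∷ [] ∷ []

    -- The pairs of D and `next D` list each triangle edge once, so an edge is named by an element
    -- of `Fin 3`.
    next : Fin 3 → Fin 3
    next zero = suc zero
    next (suc zero) = suc (suc zero)
    next (suc (suc zero)) = zero

    packing = rainbowColouring (fromList xs) (∣fromList∣ uniq)

    T : Fin ℓ → Subgraph G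
    T = proj₁ packing

    module T i = Subgraph (T i)

    -- Without such an edge the triple would be independent in the tree, and having at most three
    -- colours would force a common neighbour.
    triangleEdge : ∀ i → ∃[ D ] T.Edge i (corner D) (corner (next D))
    triangleEdge i with any? (λ D → T.edge? i (corner D) (corner (next D)))
    ... | yes p = p
    ... | no ¬p with commonNeighbour {c = c} (proj₁ (proj₂ packing) i) uniq independent (ℕ.≤-pred (ℕ.≰⇒> 4≰t))
      where
      no-edge : ∀ D → ¬ T.Edge i (corner D) (corner (next D))
      no-edge D e = ¬p (D , e)

      no-loop : ∀ {u} → ¬ T.Edge i u u
      no-loop e = irrefl refl (T.edge-adj i e)

      independent : ∀ {u v} → u ∈ xs → v ∈ xs → ¬ T.Edge i u v
      independent (here refl) (here refl) = no-loop
      independent (here refl) (there (here refl)) = no-edge zero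
      independent (here refl) (there (there (here refl))) = no-edge (suc (suc zero)) ∘ T.edge-sym i
      independent (there (here refl)) (here refl) = no-edge zero ∘ T.edge-sym i
      independent (there (here refl)) (there (here refl)) = no-loop
      independent (there (here refl)) (there (there (here refl))) = no-edge (suc zero)
      independent (there (there (here refl))) (here refl) = no-edge (suc (suc zero))
      independent (there (there (here refl))) (there (here refl)) = no-edge (suc zero) ∘ T.edge-sym i
      independent (there (there (here refl))) (there (there (here refl))) = no-loop
    ... | h , e₀ , e₁ , e₂ with noCommonNeighbour h
    ...   | zero , ¬adj = contradiction (T.edge-adj i e₀) ¬adj
    ...   | suc zero , ¬adj = contradiction (T.edge-adj i e₁) ¬adj
    ...   | suc (suc zero) , ¬adj = contradiction (T.edge-adj i e₂) ¬adj

    noSharedEdge : ¬ (∃[ i ] ∃[ j ] (i Fin.< j × proj₁ (triangleEdge i) ≡ proj₁ (triangleEdge j)))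
    noSharedEdge (i , j , i<j , eq) = proj₁ (proj₂ (proj₂ packing) i j (<⇒≢ i<j)) _ _
      (proj₂ (triangleEdge i) ,
       subst (λ D → T.Edge j (corner D) (corner (next D))) (sym eq) (proj₂ (triangleEdge j)))

-- One corner is taken from each class; any vertex is non-adjacent to the corner of its own class.
tripartite-colourable⇒4≤ : ∀ {n ℓ t} → 1 ≤ n → 4 ≤ ℓ →
  RainbowColourable 3 ℓ (completeMultipartite 3 n) t → 4 ≤ t
tripartite-colourable⇒4≤ {suc n} _ = noCommonNeighbour⇒4≤ corner corner-injective
  (λ h → quotient {3} (suc n) h , λ adj → adj (class-corner _))
  where
  corner : Fin 3 → Fin (3 * suc n)
  corner D = combine D zero

  class-corner : ∀ D → quotient {3} (suc n) (corner D) ≡ D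
  class-corner D = cong proj₁ (remQuot-combine D (zero {n}))

  corner-injective : ∀ {D D′} → corner D ≡ corner D′ → D ≡ D′
  corner-injective {D} {D′} e = proj₁ (combine-injective D (zero {n}) D′ zero e)

-- The values of the index for large n

theorem3p3 : (ℓ r : ℕ) → 1 ≤ ℓ → 3 ≤ r →
    ∃[ N ] (1 ≤ N × (∀ n → N ≤ n →
    (r ≡ 3 → (ℓ ≡ 1 ⊎ ℓ ≡ 2 ⊎ ℓ ≡ 3) → IsRainbowIndex 3 ℓ (completeMultipartite r n) 3) ×
    (r ≡ 3 → 4 ≤ ℓ → IsRainbowIndex 3 ℓ (completeMultipartite r n) 4) ×
    (4 ≤ r → IsRainbowIndex 3 ℓ (completeMultipartite r n) 3)))
-- The arguments 2 and 3 are one less than the number of colours. In the threshold, the summand 3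
-- provides three vertices in one class for the lower bound.
theorem3p3 ℓ r 1≤ℓ 3≤r with eventuallyRich ℓ r 2 1≤ℓ | eventuallyRich ℓ r 3 1≤ℓ
... | N₃ , rich₃ | N₄ , rich₄ = 3 + (N₃ + N₄) , s≤s z≤n , λ n N≤n →
  let 3≤n  = ℕ.≤-trans (ℕ.m≤m+n 3 (N₃ + N₄)) N≤n
      N₃+N₄≤n = ℕ.≤-trans (ℕ.m≤n+m (N₃ + N₄) 3) N≤n
      R₃ = rich₃ n (ℕ.≤-trans (ℕ.m≤m+n N₃ N₄) N₃+N₄≤n)
      R₄ = rich₄ n (ℕ.≤-trans (ℕ.m≤n+m N₄ N₃) N₃+N₄≤n)
      3≤t = λ s → colourable⇒3≤ {r} {n} {ℓ} {s} (inject≤ zero 3≤r) 3≤n 1≤ℓ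
  in (λ _ ℓ≡ → colourable-ℓ≤3 R₃ completable₃ zero 3≤r 1≤ℓ (ℓ≤3 ℓ≡) , 3≤t) ,
     (λ { refl 4≤ℓ → colourable-t≥4 R₄ completable₄ zero 3≤r ,
                     λ s → tripartite-colourable⇒4≤ (ℕ.≤-trans (s≤s z≤n) 3≤n) 4≤ℓ }) ,
     λ 4≤r → colourable-r≥4 R₃ (proj₂ (proj₂ (completable₃ zero))) 4≤r , 3≤t
  where
  ℓ≤3 : ℓ ≡ 1 ⊎ ℓ ≡ 2 ⊎ ℓ ≡ 3 → ℓ ≤ 3
  ℓ≤3 (inj₁ refl) = s≤s z≤n
  ℓ≤3 (inj₂ (inj₁ refl)) = s≤s (s≤s z≤n)
  ℓ≤3 (inj₂ (inj₂ refl)) = ℕ.≤-refl
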